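{- Let $n\ge 2$, let $v=(v_1,\dots,v_n)^T,\ u=(u_1,\dots,u_n)^T\in\mathbb{C}^n$, and let $H=vv^*+uu^*$. Then $$\det(\mathscr{C}_1(H))=\frac{\operatorname{per}(H)}{n}\prod_{k=1}^{n-1}n\,(k-1)!\,(n-1-k)!\cdot\prod_{1\le i<j\le n}|v_iu_j-v_ju_i|^2 .$$
   Context: For an $n\times n$ complex matrix $A=(a_{ij})$, $\operatorname{per}(A)=\sum_{\sigma\in S_n}\prod_{i=1}^n a_{i\sigma(i)}$. $\mathscr{C}_1(A)$ is the $n\times n$ matrix whose $(i,j)$ entry is $a_{ij}\cdot\operatorname{per}(A(i|j))$, where $A(i|j)$ is the $(n-1)\times(n-1)$ matrix obtained from $A$ by deleting row $i$ and column $j$ (the permanent of the empty matrix is $1$). -}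

module Defs where

open import Level using (_⊔_)
open import Data.Nat as ℕ using (ℕ; zero; suc)
open import Data.Nat.ListAction using (sum)
open import Data.Nat.DivMod using (_/_)
open import Data.Fin as Fin using (Fin; zero; suc; toℕ; punchIn)
open import Data.List as List using (List; []; _∷_; concatMap; map; foldr; allFin)
open import Data.Bool using (Bool; true; false; if_then_else_)
open import Relation.Nullary.Decidable using (does)
open import Algebra.Bundles using (CommutativeRing)

perms : (n : ℕ) → List (Fin n → Fin n)
perms zero = (λ ()) ∷ []
perms (suc n) =
  concatMap (λ i → map (λ σ → extend i σ) (perms n)) (allFin (suc n))
  where
  extend : Fin (suc n) → (Fin n → Fin n) → Fin (suc n) → Fin (suc n)
  extend i σ zero    = i
  extend i σ (suc j) = punchIn i (σ j)

inversions : {n : ℕ} → (Fin n → Fin n) → ℕ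
inversions {n} σ =
  sum (map (λ a → sum (map (λ b →
     if does (toℕ a ℕ.<? toℕ b) then
       (if does (toℕ (σ b) ℕ.<? toℕ (σ a)) then 1 else 0)
     else 0) (allFin n))) (allFin n))

-- The natural-number constant
--   (1/n) * ∏_{k=1}^{n-1} n (k-1)! (n-1-k)!
-- (exact division in ℕ; the product is divisible by n when n ≥ 2).
prodℕ : ℕ → (ℕ → ℕ) → ℕ
prodℕ zero    f = 1
prodℕ (suc m) f = prodℕ m f ℕ.* f (suc m)

coeff : ℕ → ℕ
coeff zero    = 0   -- irrelevant (theorem assumes n ≥ 2)
coeff (suc m) =
  prodℕ m (λ k → suc m ℕ.* ((k ℕ.∸ 1) ℕ.!) ℕ.* ((suc m ℕ.∸ 1 ℕ.∸ k) ℕ.!)) / suc m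

module OverRing {c ℓ} (R : CommutativeRing c ℓ) where
  open CommutativeRing R hiding (zero)

  Matrix : ℕ → Set c
  Matrix n = Fin n → Fin n → Carrier

  Vector : ℕ → Set c
  Vector n = Fin n → Carrier

  sumFin : {n : ℕ} → (Fin n → Carrier) → Carrier
  sumFin {zero}  f = 0#
  sumFin {suc n} f = f zero + sumFin (λ i → f (suc i))

  prodFin : {n : ℕ} → (Fin n → Carrier) → Carrier
  prodFin {zero}  f = 1#
  prodFin {suc n} f = f zero * prodFin (λ i → f (suc i))

  sumList : {A : Set} → (A → Carrier) → List A → Carrier
  sumList f = foldr (λ a acc → f a + acc) 0#

  fromℕ : ℕ → Carrier
  fromℕ zero    = 0#
  fromℕ (suc n) = 1# + fromℕ n

  signPow : ℕ → Carrier
  signPow zero    = 1#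
  signPow (suc k) = - (signPow k)

  sgn : {n : ℕ} → (Fin n → Fin n) → Carrier
  sgn σ = signPow (inversions σ)

  per : {n : ℕ} → Matrix n → Carrier
  per {n} A = sumList (λ σ → prodFin (λ i → A i (σ i))) (perms n)

  det : {n : ℕ} → Matrix n → Carrier
  det {n} A = sumList (λ σ → sgn σ * prodFin (λ i → A i (σ i))) (perms n)

  minor : {n : ℕ} → Matrix (suc n) → Fin (suc n) → Fin (suc n) → Matrix n
  minor A i j a b = A (punchIn i a) (punchIn j b)

  C₁ : {n : ℕ} → Matrix n → Matrix n
  C₁ {zero}  A ()
  C₁ {suc n} A i j = A i j * per (minor A i j)

  -- Standing structure replacing complex conjugation: an involutive
  -- ring automorphism.
  record IsInvolution (conj : Carrier → Carrier) : Set (c ⊔ ℓ) where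
    field
      cong-conj : ∀ {x y} → x ≈ y → conj x ≈ conj y
      conj-+    : ∀ x y → conj (x + y) ≈ conj x + conj y
      conj-*    : ∀ x y → conj (x * y) ≈ conj x * conj y
      conj-1    : conj 1# ≈ 1#
      conj-conj : ∀ x → conj (conj x) ≈ x

  module _ (conj : Carrier → Carrier) where
    absSq : Carrier → Carrier
    absSq x = x * conj x

    rank2H : {n : ℕ} → Vector n → Vector n → Matrix n
    rank2H v u i j = v i * conj (v j) + u i * conj (u j)

    vandermondeLike : {n : ℕ} → Vector n → Vector n → Carrier
    vandermondeLike v u = prodFin (λ i → prodFin (λ j →
      if does (toℕ i ℕ.<? toℕ j)
        then absSq (v i * u j - v j * u i)
        else 1#))

{-# OPTIONS --safe #-}
module Submission where

-- Write H = v wᵀ + u zᵀ with w = v̄, z = ū, let E_k be the coefficient of tᵏ in ∏ᵢ (vᵢ t + uᵢ), F_k that of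
-- ∏ᵢ (wᵢ t + zᵢ), and E_k(i), F_k(i) those of the products without the i-th factor. Expanding the permanent
-- gives per H = ∑ₖ k! (n-k)! E_k F_k. Applied to the minors, and with vᵢ E_{k-1}(i) = E_k - uᵢ E_k(i), it
-- gives C₁(H) = X M Yᵀ, where the rows of X are (1, uᵢ E_1(i), …, uᵢ E_{n-1}(i)), Y is the same for w and z,
-- and M is nonzero only in its first row, first column and diagonal. Row operations reduce X to the
-- coefficient matrix of the polynomials ∏_{j ≠ i} (vⱼ t + uⱼ), so that det X = ∏_{i<j} (vᵢ uⱼ - vⱼ uᵢ), while
-- det M = coeff n · per H. No step divides, so the identity holds over every commutative ring.
--
-- Multiplicativity of det comes from the exterior algebra: n vectors in Rⁿ multiply to det times the
-- top basis element, and a matrix induces an algebra homomorphism.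

open import Defs
open import Algebra.Bundles using (CommutativeRing; RawRing)
import Algebra.Properties.AbelianGroup as AbelianGroupProperties
import Algebra.Properties.Group as GroupProperties
import Algebra.Properties.Ring as RingProperties
import Algebra.Properties.Semiring.Mult.TCOptimised as SemiringMult
import Algebra.Solver.Ring as RingSolver
open import Algebra.Solver.Ring.AlmostCommutativeRing using (_-Raw-AlmostCommutative⟶_; fromCommutativeRing)
open import Data.Bool using (Bool; true; false; if_then_else_)
open import Data.Fin using (Fin; zero; suc; toℕ; punchIn)
import Data.Fin.Properties as Fin
open import Data.Integer as ℤ using (ℤ; +_; -[1+_]; _⊖_; _◃_)
import Data.Integer.Properties as ℤ
open import Data.List using (List; []; _∷_; _++_; concatMap; map; tabulate; allFin)
open import Data.List.Properties using (map-tabulate; map-cong)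
open import Data.List.Relation.Unary.All as All using (All; []; _∷_)
import Data.List.Relation.Unary.All.Properties as All
open import Data.Maybe using (Maybe; just; nothing)
open import Data.Nat as ℕ using (ℕ; zero; suc; _≤_; _<_; _<ᵇ_; z≤n; s≤s; _∸_; _!; _^_)
open import Data.Nat.DivMod using (_/_; m*n/n≡m)
open import Data.Nat.ListAction using (sum)
import Data.Nat.Properties as ℕ
open import Algebra.Properties.CommutativeSemigroup ℕ.*-commutativeSemigroup using (x∙yz≈y∙xz)
import Data.Nat.Tactic.RingSolver as ℕ-Solver
open import Data.Product using (Σ-syntax; _,_) renaming (_×_ to _∧_)
import Data.Sign as Sign
open import Data.Sum using (_⊎_; inj₁; inj₂)
open import Data.Vec using (Vec; []; _∷_; insertAt; replicate)
open import Function using (_∘_; id)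
open import Relation.Binary.PropositionalEquality as ≡ using (_≡_)
open import Relation.Nullary using (yes; no)

-- Inversions of the permutations in perms (suc n)

-- The proof leaves the Hermitian setting at once: a minor of H deletes a row and a column of
-- different index, so it is built from four unrelated vectors. Treating w and z as independent of v
-- and u also separates det X from det Y; conjugation returns only to match the second product with
-- the conjugate of the first. Two steps usually done by division are recast. The Vandermonde-like
-- determinant cannot be reduced to the classical one by dividing by the vᵢ, so a resultant with a
-- linear form takes the place of evaluation at a root. And det M would be a Schur complement s - ∑
-- rₖ cₖ / dₖ; here dₖ = n gₖ with gₖ = k! (n-2-k)!, and rₖ cₖ is a multiple of gₖ, so the cleared
-- form s ∏ dₖ - ∑ₖ rₖ cₖ ∏_{l ≠ k} d_l has the common factor n^{n-2} ∏ gₖ. The missing n, against n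
-- - 1 diagonal entries, is the 1/n of the theorem.

<ᵇ-true : ∀ {m n} → m < n → (m <ᵇ n) ≡ true
<ᵇ-true {zero}  (s≤s z≤n)       = ≡.refl
<ᵇ-true {suc m} (s≤s p@(s≤s _)) = <ᵇ-true p

<ᵇ-false : ∀ {m n} → n ≤ m → (m <ᵇ n) ≡ false
<ᵇ-false z≤n     = ≡.refl
<ᵇ-false (s≤s p) = <ᵇ-false p

punchIn-<ᵇ-below : ∀ {n} (i : Fin (suc n)) (x : Fin n) t → t ≤ toℕ i →
  (toℕ (punchIn i x) <ᵇ t) ≡ (toℕ x <ᵇ t)
punchIn-<ᵇ-below zero    x       zero    z≤n     = ≡.refl
punchIn-<ᵇ-below (suc i) zero    t       p       = ≡.refl
punchIn-<ᵇ-below (suc i) (suc x) zero    p       = ≡.refl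
punchIn-<ᵇ-below (suc i) (suc x) (suc t) (s≤s p) = punchIn-<ᵇ-below i x t p

punchIn-<ᵇ-above : ∀ {n} (i : Fin (suc n)) (x : Fin n) t → toℕ i ≤ t →
  (toℕ (punchIn i x) <ᵇ suc t) ≡ (toℕ x <ᵇ t)
punchIn-<ᵇ-above zero    x       t       p       = ≡.refl
punchIn-<ᵇ-above (suc i) zero    (suc t) (s≤s p) = ≡.refl
punchIn-<ᵇ-above (suc i) (suc x) (suc t) (s≤s p) = punchIn-<ᵇ-above i x t p

punchIn-<ᵇ : ∀ {n} (i : Fin (suc n)) (x y : Fin n) →
  (toℕ (punchIn i x) <ᵇ toℕ (punchIn i y)) ≡ (toℕ x <ᵇ toℕ y)
punchIn-<ᵇ zero    x       y       = ≡.refl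
punchIn-<ᵇ (suc i) zero    zero    = ≡.refl
punchIn-<ᵇ (suc i) zero    (suc y) = ≡.refl
punchIn-<ᵇ (suc i) (suc x) zero    = ≡.refl
punchIn-<ᵇ (suc i) (suc x) (suc y) = punchIn-<ᵇ i x y

sum-allFin-suc : ∀ {n} (f : Fin (suc n) → ℕ) →
  sum (map f (allFin (suc n))) ≡ f zero ℕ.+ sum (map (f ∘ suc) (allFin n))
sum-allFin-suc f = ≡.cong (λ l → f zero ℕ.+ sum l)
  (≡.trans (map-tabulate suc f) (≡.sym (map-tabulate id (f ∘ suc))))

sum-allFin-cong : ∀ {n} {f g : Fin n → ℕ} → (∀ i → f i ≡ g i) →
  sum (map f (allFin n)) ≡ sum (map g (allFin n))
sum-allFin-cong {n} e = ≡.cong sum (map-cong e (allFin n))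

indicator : Bool → ℕ
indicator b = if b then 1 else 0

-- A permutation of `Fin n` takes exactly `t` values below each `t ≤ n`. Bijectivity is recorded in
-- this form because counting inversions uses just these numbers.
countBelow : ∀ {m n} → (Fin m → Fin n) → ℕ → ℕ
countBelow {m} σ t = sum (map (λ j → indicator (toℕ (σ j) <ᵇ t)) (allFin m))

-- Pointwise, since functions that agree everywhere need not be propositionally equal here.
Extends : ∀ {n} → Fin (suc n) → (Fin n → Fin n) → (Fin (suc n) → Fin (suc n)) → Set
Extends i σ τ = ∀ j → τ j ≡ cons j
  where
  cons : Fin _ → Fin _
  cons zero    = i
  cons (suc j) = punchIn i (σ j)

-- The extension map of Defs.perms is local to it, so it is recovered here by unification.
perms-suc : ∀ n → Σ[ ext ∈ (Fin (suc n) → (Fin n → Fin n) → Fin (suc n) → Fin (suc n)) ]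
  perms (suc n) ≡ concatMap (λ i → map (ext i) (perms n)) (allFin (suc n)) ∧ (∀ i σ → Extends i σ (ext i σ))
perms-suc n = _ , ≡.refl , λ { i σ zero → ≡.refl ; i σ (suc j) → ≡.refl }

-- The values after the first skip `i`. For `t ≤ i` the skip lies above the threshold and the count
-- is that of `σ` at `t`; for `t > i` the value `i` contributes one and the others are counted by
-- `σ` at `t - 1`.
countBelow-extends : ∀ {n} {i : Fin (suc n)} {σ τ} → Extends i σ τ →
  (∀ t → t ≤ n → countBelow σ t ≡ t) → ∀ t → t ≤ suc n → countBelow τ t ≡ t
countBelow-extends {n} {i} {σ} {τ} ext bij t t≤1+n = ≡.trans expand (count t t≤1+n (ℕ.≤-<-connex t (toℕ i)))
  where
  expand : countBelow τ t ≡ indicator (toℕ i <ᵇ t) ℕ.+ countBelow (punchIn i ∘ σ) t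
  expand = ≡.trans (sum-allFin-suc (λ j → indicator (toℕ (τ j) <ᵇ t)))
    (≡.cong₂ ℕ._+_ (≡.cong (λ x → indicator (toℕ x <ᵇ t)) (ext zero))
      (sum-allFin-cong (λ j → ≡.cong (λ x → indicator (toℕ x <ᵇ t)) (ext (suc j)))))
  count : ∀ t → t ≤ suc n → t ≤ toℕ i ⊎ toℕ i < t →
    indicator (toℕ i <ᵇ t) ℕ.+ countBelow (punchIn i ∘ σ) t ≡ t
  count t _ (inj₁ t≤i) = ≡.cong₂ ℕ._+_ (≡.cong indicator (<ᵇ-false t≤i))
    (≡.trans (sum-allFin-cong (λ j → ≡.cong indicator (punchIn-<ᵇ-below i (σ j) t t≤i)))
             (bij t (ℕ.≤-trans t≤i (Fin.toℕ≤pred[n] i))))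
  count (suc t) (s≤s t≤n) (inj₂ i<t@(s≤s i≤t)) = ≡.cong₂ ℕ._+_ (≡.cong indicator (<ᵇ-true i<t))
    (≡.trans (sum-allFin-cong (λ j → ≡.cong indicator (punchIn-<ᵇ-above i (σ j) t i≤t)))
             (bij t t≤n))

countBelow-perms : ∀ n → All (λ σ → ∀ t → t ≤ n → countBelow σ t ≡ t) (perms n)
countBelow-perms zero    = (λ { zero z≤n → ≡.refl }) ∷ []
countBelow-perms (suc n) with ext , eq , extends ← perms-suc n = ≡.subst (All _) (≡.sym eq)
  (All.concat⁺ (All.map⁺ (All.tabulate⁺ (λ i → All.map⁺
    (All.map (λ {σ} → countBelow-extends (extends i σ)) (countBelow-perms n))))))

-- All values below `i` occur after position zero, so the first position takes part in `toℕ i`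
-- inversions; `punchIn i` is monotone and preserves the inversions of `σ`.
inversions-extends : ∀ {n} {i : Fin (suc n)} {σ τ} → Extends i σ τ →
  (∀ t → t ≤ n → countBelow σ t ≡ t) → inversions τ ≡ toℕ i ℕ.+ inversions σ
inversions-extends {n} {i} {σ} {τ} ext bij = ≡.trans
  (sum-allFin-suc (λ a → sum (map (inv a) (allFin (suc n)))))
  (≡.cong₂ ℕ._+_ row₀ (sum-allFin-cong rowₛ))
  where
  inv : Fin (suc n) → Fin (suc n) → ℕ
  inv a b = if toℕ a <ᵇ toℕ b then indicator (toℕ (τ b) <ᵇ toℕ (τ a)) else 0
  row₀ : sum (map (inv zero) (allFin (suc n))) ≡ toℕ i
  row₀ = ≡.trans (sum-allFin-suc (inv zero)) (≡.trans
    (sum-allFin-cong (λ b → ≡.cong indicator (≡.trans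
      (≡.cong₂ (λ x y → toℕ x <ᵇ toℕ y) (ext (suc b)) (ext zero))
      (punchIn-<ᵇ-below i (σ b) (toℕ i) ℕ.≤-refl))))
    (bij (toℕ i) (Fin.toℕ≤pred[n] i)))
  rowₛ : ∀ a → sum (map (inv (suc a)) (allFin (suc n))) ≡
    sum (map (λ b → if toℕ a <ᵇ toℕ b then indicator (toℕ (σ b) <ᵇ toℕ (σ a)) else 0) (allFin n))
  rowₛ a = ≡.trans (sum-allFin-suc (inv (suc a))) (sum-allFin-cong (λ b →
    ≡.cong (λ x → if toℕ a <ᵇ toℕ b then indicator x else 0)
      (≡.trans (≡.cong₂ (λ x y → toℕ x <ᵇ toℕ y) (ext (suc b)) (ext (suc a)))
               (punchIn-<ᵇ i (σ b) (σ a)))))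

-- The number of factors of the basis element of the exterior algebra that `s` encodes.
degree : ∀ {n} → Vec Bool n → ℕ
degree []          = 0
degree (false ∷ s) = degree s
degree (true  ∷ s) = suc (degree s)

degree≤n : ∀ {n} (s : Vec Bool n) → degree s ≤ n
degree≤n []          = z≤n
degree≤n (false ∷ s) = ℕ.m≤n⇒m≤1+n (degree≤n s)
degree≤n (true  ∷ s) = s≤s (degree≤n s)

-- Factorial weights

-- The number of permutations that carry a given `k`-set of rows onto a given `k`-set of columns,
-- hence the coefficient of E_k F_k in the permanent.
factorialWeight : ℕ → ℕ → ℕ
factorialWeight n k = k ! ℕ.* (n ∸ k) !

factorialWeight-suc : ∀ n k → factorialWeight (suc n) (suc k) ≡ suc k ℕ.* factorialWeight n k
factorialWeight-suc n k = ℕ.*-assoc (suc k) (k !) ((n ∸ k) !)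

factorialWeight-sucˡ : ∀ {n k} → k ≤ n → factorialWeight (suc n) k ≡ suc (n ∸ k) ℕ.* factorialWeight n k
factorialWeight-sucˡ {n} {k} k≤n rewrite ℕ.+-∸-assoc 1 k≤n = x∙yz≈y∙xz (k !) (suc (n ∸ k)) ((n ∸ k) !)

-- For n = `suc m` this is the factor (k-1)! (n-1-k)! of the theorem with its index lowered by one.
diagonalWeight : ℕ → ℕ → ℕ
diagonalWeight m k = k ! ℕ.* (m ∸ suc k) !

∸-suc-< : ∀ {m k} → k < m → m ∸ k ≡ suc (m ∸ suc k)
∸-suc-< {suc m} {k} (s≤s k≤m) = ℕ.+-∸-assoc 1 k≤m

factorialWeight-diagonalWeight : ∀ {m k} → k < m → factorialWeight m k ≡ (m ∸ k) ℕ.* diagonalWeight m k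
factorialWeight-diagonalWeight {m} {k} k<m rewrite ∸-suc-< k<m = x∙yz≈y∙xz (k !) (suc (m ∸ suc k)) ((m ∸ suc k) !)

-- Split `suc m` as `(m ∸ k) + suc k`: each part completes one of the two factorials. This is where
-- the factors n (k-1)! (n-1-k)! of the theorem come from.
factorialWeight-+ : ∀ {m k} → k < m →
  suc m ℕ.* diagonalWeight m k ≡ factorialWeight m k ℕ.+ factorialWeight m (suc k)
factorialWeight-+ {m} {k} k<m = begin
  suc m ℕ.* (k ! ℕ.* j !)                                 ≡⟨ ≡.cong (λ x → suc x ℕ.* (k ! ℕ.* j !)) (ℕ.m∸n+n≡m k<m) ⟨
  suc (j ℕ.+ suc k) ℕ.* (k ! ℕ.* j !)                     ≡⟨ identity j (suc k) (k !) (j !) ⟩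
  k ! ℕ.* (suc j ℕ.* j !) ℕ.+ suc k ℕ.* k ! ℕ.* j !       ≡⟨ ≡.cong (λ x → k ! ℕ.* x ! ℕ.+ suc k ℕ.* k ! ℕ.* j !) (∸-suc-< k<m) ⟨
  factorialWeight m k ℕ.+ factorialWeight m (suc k)       ∎
  where
  open ≡.≡-Reasoning
  j = m ∸ suc k
  identity : ∀ j l a b → suc (j ℕ.+ l) ℕ.* (a ℕ.* b) ≡ a ℕ.* (suc j ℕ.* b) ℕ.+ l ℕ.* a ℕ.* b
  identity = ℕ-Solver.solve-∀

prodℕ-scale : ∀ x m (f g : ℕ → ℕ) → prodℕ m (λ k → x ℕ.* f k ℕ.* g k) ≡ x ^ m ℕ.* prodℕ m (λ k → f k ℕ.* g k)
prodℕ-scale x zero    f g = ≡.refl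
prodℕ-scale x (suc m) f g = ≡.trans (≡.cong (ℕ._* (x ℕ.* f (suc m) ℕ.* g (suc m))) (prodℕ-scale x m f g))
  (identity x (x ^ m) (prodℕ m (λ k → f k ℕ.* g k)) (f (suc m)) (g (suc m)))
  where
  identity : ∀ x y p a b → y ℕ.* p ℕ.* (x ℕ.* a ℕ.* b) ≡ x ℕ.* y ℕ.* (p ℕ.* (a ℕ.* b))
  identity = ℕ-Solver.solve-∀

-- The product has n - 1 ≥ 1 factors n, and the division removes exactly one of them.
coeff-explicit : ∀ m → let n = suc (suc m) in
  coeff n ≡ n ^ m ℕ.* prodℕ (suc m) (λ k → (k ∸ 1) ! ℕ.* (suc m ∸ k) !)
coeff-explicit m = ≡.trans
  (≡.cong (_/ n) (≡.trans (prodℕ-scale n (suc m) (λ k → (k ∸ 1) !) (λ k → (suc m ∸ k) !))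
    (identity n (n ^ m) P)))
  (m*n/n≡m (n ^ m ℕ.* P) n)
  where
  n = suc (suc m)
  P = prodℕ (suc m) (λ k → (k ∸ 1) ! ℕ.* (suc m ∸ k) !)
  identity : ∀ x y p → x ℕ.* y ℕ.* p ≡ y ℕ.* p ℕ.* x
  identity = ℕ-Solver.solve-∀

module CommutativeRingTheory {c ℓ} (R : CommutativeRing c ℓ) where
  open CommutativeRing R hiding (zero)
  open OverRing R
  open import Relation.Binary.Reasoning.Setoid setoid

  -- Polynomial identities over an arbitrary commutative ring

  module IntegerCoefficientSolver where
    open SemiringMult semiring
    open RingProperties ring using (-‿distribˡ-*; -‿distribʳ-*; -0#≈0#; -‿involutive)
    open AbelianGroupProperties +-abelianGroup using (⁻¹-∙-comm)

    ⟦_⟧ : ℤ → Carrier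
    ⟦ + n ⟧      = n × 1#
    ⟦ -[1+ n ] ⟧ = - (suc n × 1#)

    ⟦⊖⟧ : ∀ m n → ⟦ m ⊖ n ⟧ ≈ m × 1# - n × 1#
    ⟦⊖⟧ m zero = sym (trans (+-congˡ -0#≈0#) (+-identityʳ _))
    ⟦⊖⟧ zero (suc n) = sym (+-identityˡ _)
    ⟦⊖⟧ (suc m) (suc n) = begin
      ⟦ suc m ⊖ suc n ⟧                   ≡⟨ ≡.cong ⟦_⟧ (ℤ.[1+m]⊖[1+n]≡m⊖n m n) ⟩
      ⟦ m ⊖ n ⟧                           ≈⟨ ⟦⊖⟧ m n ⟩
      a - b                               ≈⟨ +-identityˡ _ ⟨
      0# + (a - b)                        ≈⟨ +-congʳ (-‿inverseʳ 1#) ⟨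
      1# - 1# + (a - b)                   ≈⟨ +-assoc _ _ _ ⟩
      1# + (- 1# + (a - b))               ≈⟨ +-congˡ (trans (sym (+-assoc _ _ _)) (trans (+-congʳ (+-comm _ _)) (+-assoc _ _ _))) ⟩
      1# + (a + (- 1# - b))               ≈⟨ +-assoc _ _ _ ⟨
      1# + a + (- 1# - b)                 ≈⟨ +-congˡ (⁻¹-∙-comm _ _) ⟩
      1# + a - (1# + b)                   ≈⟨ +-cong (1+× m 1#) (-‿cong (1+× n 1#)) ⟨
      suc m × 1# - suc n × 1#             ∎
      where
      a = m × 1#
      b = n × 1#

    ⟦+⟧ : ∀ i j → ⟦ i ℤ.+ j ⟧ ≈ ⟦ i ⟧ + ⟦ j ⟧
    ⟦+⟧ (+ m)      (+ n)      = ×-homo-+ 1# m n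
    ⟦+⟧ (+ m)      (-[1+ n ]) = ⟦⊖⟧ m (suc n)
    ⟦+⟧ (-[1+ m ]) (+ n)      = trans (⟦⊖⟧ n (suc m)) (+-comm _ _)
    ⟦+⟧ (-[1+ m ]) (-[1+ n ]) = begin
      - (suc (suc (m ℕ.+ n)) × 1#)        ≡⟨ ≡.cong (λ k → - (suc k × 1#)) (ℕ.+-suc m n) ⟨
      - ((suc m ℕ.+ suc n) × 1#)          ≈⟨ -‿cong (×-homo-+ 1# (suc m) (suc n)) ⟩
      - (suc m × 1# + suc n × 1#)         ≈⟨ ⁻¹-∙-comm _ _ ⟨
      - (suc m × 1#) - suc n × 1#         ∎

    ⟦-⟧ : ∀ i → ⟦ ℤ.- i ⟧ ≈ - ⟦ i ⟧
    ⟦-⟧ (+ zero)   = sym -0#≈0#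
    ⟦-⟧ (+ suc n)  = refl
    ⟦-⟧ (-[1+ n ]) = sym (-‿involutive _)

    ⟦-◃⟧ : ∀ n → ⟦ Sign.- ◃ n ⟧ ≈ - (n × 1#)
    ⟦-◃⟧ zero    = sym -0#≈0#
    ⟦-◃⟧ (suc n) = refl

    ⟦+◃⟧ : ∀ n → ⟦ Sign.+ ◃ n ⟧ ≈ n × 1#
    ⟦+◃⟧ zero    = refl
    ⟦+◃⟧ (suc n) = refl

    ⟦*⟧ : ∀ i j → ⟦ i ℤ.* j ⟧ ≈ ⟦ i ⟧ * ⟦ j ⟧
    ⟦*⟧ (+ m)      (+ n)      = trans (⟦+◃⟧ (m ℕ.* n)) (×1-homo-* m n)
    ⟦*⟧ (+ m)      (-[1+ n ]) = trans (⟦-◃⟧ (m ℕ.* suc n)) (trans (-‿cong (×1-homo-* m (suc n))) (-‿distribʳ-* _ _))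
    ⟦*⟧ (-[1+ m ]) (+ n)      = trans (⟦-◃⟧ (suc m ℕ.* n)) (trans (-‿cong (×1-homo-* (suc m) n)) (-‿distribˡ-* _ _))
    ⟦*⟧ (-[1+ m ]) (-[1+ n ]) = begin
      ⟦ Sign.+ ◃ suc m ℕ.* suc n ⟧        ≈⟨ ⟦+◃⟧ (suc m ℕ.* suc n) ⟩
      (suc m ℕ.* suc n) × 1#              ≈⟨ ×1-homo-* (suc m) (suc n) ⟩
      a * b                               ≈⟨ -‿involutive _ ⟨
      - - (a * b)                         ≈⟨ -‿cong (-‿distribʳ-* _ _) ⟩
      - (a * - b)                         ≈⟨ -‿distribˡ-* _ _ ⟩
      - a * - b                           ∎
      where
      a = suc m × 1#
      b = suc n × 1#

    ℤ-rawRing : RawRing _ _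
    ℤ-rawRing = record
      { Carrier = ℤ ; _≈_ = _≡_ ; _+_ = ℤ._+_ ; _*_ = ℤ._*_ ; -_ = ℤ.-_ ; 0# = + 0 ; 1# = + 1 }

    morphism : ℤ-rawRing -Raw-AlmostCommutative⟶ fromCommutativeRing R
    morphism = record
      { ⟦_⟧ = ⟦_⟧ ; +-homo = ⟦+⟧ ; *-homo = ⟦*⟧ ; -‿homo = ⟦-⟧ ; 0-homo = refl ; 1-homo = refl }

    -- Cancellation is decided on integer coefficients, so equality in the ring itself may be
    -- undecidable.
    _≟_ : ∀ i j → Maybe (⟦ i ⟧ ≈ ⟦ j ⟧)
    i ≟ j with i ℤ.≟ j
    ... | yes i≡j = just (reflexive (≡.cong ⟦_⟧ i≡j))
    ... | no  _   = nothing

    open RingSolver ℤ-rawRing (fromCommutativeRing R) morphism _≟_ public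
      using (solve; _:=_; _:+_; _:*_; _:-_; :-_; con)

  open IntegerCoefficientSolver using (solve; _:=_; _:+_; _:*_; _:-_; :-_; con)

  -- Finite sums and products

  sumFin-cong : ∀ {n} {f g : Fin n → Carrier} → (∀ i → f i ≈ g i) → sumFin f ≈ sumFin g
  sumFin-cong {zero}  e = refl
  sumFin-cong {suc n} e = +-cong (e zero) (sumFin-cong (λ i → e (suc i)))

  prodFin-cong : ∀ {n} {f g : Fin n → Carrier} → (∀ i → f i ≈ g i) → prodFin f ≈ prodFin g
  prodFin-cong {zero}  e = refl
  prodFin-cong {suc n} e = *-cong (e zero) (prodFin-cong (λ i → e (suc i)))

  sumFin-0 : ∀ {n} {f : Fin n → Carrier} → (∀ i → f i ≈ 0#) → sumFin f ≈ 0#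
  sumFin-0 {zero}  e = refl
  sumFin-0 {suc n} e = trans (+-cong (e zero) (sumFin-0 (λ i → e (suc i)))) (+-identityˡ 0#)

  sumFin-+ : ∀ {n} (f g : Fin n → Carrier) → sumFin (λ i → f i + g i) ≈ sumFin f + sumFin g
  sumFin-+ {zero}  f g = sym (+-identityˡ 0#)
  sumFin-+ {suc n} f g = trans (+-congˡ (sumFin-+ (f ∘ suc) (g ∘ suc)))
    (solve 4 (λ a b s t → (a :+ b) :+ (s :+ t) := (a :+ s) :+ (b :+ t)) refl _ _ _ _)

  sumFin-*ˡ : ∀ {n} x (f : Fin n → Carrier) → sumFin (λ i → x * f i) ≈ x * sumFin f
  sumFin-*ˡ {zero}  x f = sym (zeroʳ x)
  sumFin-*ˡ {suc n} x f = trans (+-congˡ (sumFin-*ˡ x (f ∘ suc))) (sym (distribˡ _ _ _))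

  sumFin-swap : ∀ {m n} (f : Fin m → Fin n → Carrier) →
    sumFin (λ i → sumFin (f i)) ≈ sumFin (λ j → sumFin (λ i → f i j))
  sumFin-swap {zero} {n} f = sym (sumFin-0 {n} (λ _ → refl))
  sumFin-swap {suc m} f = trans (+-congˡ (sumFin-swap (f ∘ suc))) (sym (sumFin-+ (f zero) _))

  -- With summands defined on all of ℕ, the top index splits off without casts between `Fin` types;
  -- coefficient sequences are indexed by ℕ for this reason.
  sumFin-last : ∀ n (f : ℕ → Carrier) →
    sumFin {suc n} (f ∘ toℕ) ≈ sumFin {n} (f ∘ toℕ) + f n
  sumFin-last zero    f = +-comm _ _
  sumFin-last (suc n) f = trans (+-congˡ (sumFin-last n (f ∘ suc))) (sym (+-assoc _ _ _))

  prodFin-last : ∀ n (f : ℕ → Carrier) →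
    prodFin {suc n} (f ∘ toℕ) ≈ prodFin {n} (f ∘ toℕ) * f n
  prodFin-last zero    f = *-comm _ _
  prodFin-last (suc n) f = trans (*-congˡ (prodFin-last n (f ∘ suc))) (sym (*-assoc _ _ _))

  prodFin-* : ∀ {n} (f g : Fin n → Carrier) → prodFin (λ i → f i * g i) ≈ prodFin f * prodFin g
  prodFin-* {zero}  f g = sym (*-identityˡ 1#)
  prodFin-* {suc n} f g = trans (*-congˡ (prodFin-* (f ∘ suc) (g ∘ suc)))
    (solve 4 (λ a b s t → (a :* b) :* (s :* t) := (a :* s) :* (b :* t)) refl _ _ _ _)

  -- Expansions of permanents and determinants

  sumList-++ : ∀ {A : Set} (F : A → Carrier) xs ys → sumList F (xs ++ ys) ≈ sumList F xs + sumList F ys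
  sumList-++ F []       ys = sym (+-identityˡ _)
  sumList-++ F (x ∷ xs) ys = trans (+-congˡ (sumList-++ F xs ys)) (sym (+-assoc _ _ _))

  sumList-concatMap-tabulate : ∀ {A B : Set} (F : B → Carrier) (h : A → List B) {n} (g : Fin n → A) →
    sumList F (concatMap h (tabulate g)) ≈ sumFin (λ i → sumList F (h (g i)))
  sumList-concatMap-tabulate F h {zero}  g = refl
  sumList-concatMap-tabulate F h {suc n} g =
    trans (sumList-++ F (h (g zero)) _) (+-congˡ (sumList-concatMap-tabulate F h (g ∘ suc)))

  sumList-map-scale : ∀ {A B : Set} {F : B → Carrier} {G : A → Carrier} {h : A → B} {y} {xs} →
    All (λ x → F (h x) ≈ y * G x) xs → sumList F (map h xs) ≈ y * sumList G xs
  sumList-map-scale []       = sym (zeroʳ _)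
  sumList-map-scale (e ∷ es) = trans (+-cong e (sumList-map-scale es)) (sym (distribˡ _ _ _))

  signPow-+ : ∀ m n → signPow (m ℕ.+ n) ≈ signPow m * signPow n
  signPow-+ zero    n = sym (*-identityˡ _)
  signPow-+ (suc m) n = trans (-‿cong (signPow-+ m n)) (solve 2 (λ x y → :- (x :* y) := :- x :* y) refl _ _)

  prodFin-extends : ∀ {n} {i : Fin (suc n)} {σ τ} → Extends i σ τ → (A : Matrix (suc n)) →
    prodFin (λ a → A a (τ a)) ≈ A zero i * prodFin (λ a → minor A zero i a (σ a))
  prodFin-extends {n} ext A = *-cong (reflexive (≡.cong (A zero) (ext zero)))
    (prodFin-cong {n} (λ a → reflexive (≡.cong (A (suc a)) (ext (suc a)))))

  -- Common source of the row expansions of `per` and `det`. The factorization is asked only of the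
  -- listed `σ`, because the sign rule depends on their bijectivity.
  sumList-perms-suc : ∀ {n} {F : (Fin (suc n) → Fin (suc n)) → Carrier}
    (G : Fin (suc n) → (Fin n → Fin n) → Carrier) (y : Fin (suc n) → Carrier) →
    (∀ i → All (λ σ → ∀ τ → Extends i σ τ → F τ ≈ y i * G i σ) (perms n)) →
    sumList F (perms (suc n)) ≈ sumFin (λ i → y i * sumList (G i) (perms n))
  sumList-perms-suc {n} {F} G y e with ext , eq , extends ← perms-suc n =
    trans (reflexive (≡.cong (sumList F) eq)) (trans
    (sumList-concatMap-tabulate F (λ i → map (ext i) (perms n)) {suc n} id)
    (sumFin-cong {suc n} (λ i → sumList-map-scale {F = F} {h = ext i}
      (All.map (λ {σ} f → f (ext i σ) (extends i σ)) (e i)))))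

  per-row : ∀ {n} (A : Matrix (suc n)) → per A ≈ sumFin (λ j → A zero j * per (minor A zero j))
  per-row {n} A = sumList-perms-suc _ _ (λ i → All.universal (λ σ τ ext → prodFin-extends ext A) (perms n))

  det-row : ∀ {n} (A : Matrix (suc n)) →
    det A ≈ sumFin (λ j → signPow (toℕ j) * A zero j * det (minor A zero j))
  det-row {n} A = sumList-perms-suc _ _ (λ i → All.map
    (λ {σ} bij τ ext → trans
      (*-cong (trans (reflexive (≡.cong signPow (inversions-extends ext bij)))
                     (signPow-+ (toℕ i) (inversions σ)))
              (prodFin-extends ext A))
      (solve 4 (λ x y z w → (x :* y) :* (z :* w) := (x :* z) :* (y :* w)) refl _ _ _ _))
    (countBelow-perms n))

  sumFin-neg : ∀ {n} (f : Fin n → Carrier) → sumFin (λ i → - f i) ≈ - sumFin f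
  sumFin-neg {zero}  f = solve 0 (con (+ 0) := :- con (+ 0)) refl
  sumFin-neg {suc n} f = trans (+-congˡ (sumFin-neg (f ∘ suc)))
    (solve 2 (λ x y → :- x :+ :- y := :- (x :+ y)) refl _ _)

  sumList-cong : ∀ {A : Set} {F G : A → Carrier} → (∀ x → F x ≈ G x) → ∀ xs → sumList F xs ≈ sumList G xs
  sumList-cong e []       = refl
  sumList-cong e (x ∷ xs) = +-cong (e x) (sumList-cong e xs)

  det-cong : ∀ {n} {A B : Matrix n} → (∀ i j → A i j ≈ B i j) → det A ≈ det B
  det-cong {n} e = sumList-cong (λ σ → *-congˡ (prodFin-cong {n} (λ i → e i (σ i)))) (perms n)

  columnExpansion : ∀ {n} → Matrix (suc n) → Carrier
  columnExpansion A = sumFin (λ i → signPow (toℕ i) * A i zero * det (minor A i zero))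

  -- A term of Cauchy's expansion along the first row and first column together.
  borderTerm : ∀ {n} → Matrix (suc (suc n)) → Fin (suc n) → Fin (suc n) → Carrier
  borderTerm A i j = signPow (toℕ i) * signPow (toℕ j) *
    (A (suc i) zero * A zero (suc j) * det (minor (minor A zero zero) i j))

  sumFin-neg-product : ∀ {k l} (s x : Fin k → Carrier) (t y : Fin l → Carrier) (d : Fin k → Fin l → Carrier) →
    sumFin (λ i → - s i * x i * sumFin (λ j → t j * y j * d i j)) ≈
    - sumFin (λ i → sumFin (λ j → s i * t j * (x i * y j * d i j)))
  sumFin-neg-product {k} {l} s x t y d = begin
    sumFin (λ i → - s i * x i * sumFin (λ j → t j * y j * d i j))
      ≈⟨ sumFin-cong {k} (λ i → trans (sym (sumFin-*ˡ {l} _ _)) (sumFin-cong {l} (λ j → shuffle _ _ _ _ _))) ⟩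
    sumFin (λ i → sumFin (λ j → - (s i * t j * (x i * y j * d i j))))
      ≈⟨ trans (sumFin-cong {k} (λ i → sumFin-neg {l} _)) (sumFin-neg {k} _) ⟩
    - sumFin (λ i → sumFin (λ j → s i * t j * (x i * y j * d i j))) ∎
    where
    shuffle : ∀ s x t y d → - s * x * (t * y * d) ≈ - (s * t * (x * y * d))
    shuffle = solve 5 (λ s x t y d → :- s :* x :* (t :* y :* d) := :- (s :* t :* (x :* y :* d))) refl

  -- Expanding along the first row and then the first column, or the other way round, gives the
  -- same expression: this yields the column expansion, and with it invariance under transposition.
  det-column : ∀ {n} (A : Matrix (suc n)) → det A ≈ columnExpansion A
  det-border : ∀ {n} (A : Matrix (suc (suc n))) →
    det A ≈ A zero zero * det (minor A zero zero) - sumFin (λ i → sumFin (borderTerm A i))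

  det-column {zero}  A = det-row A
  -- The recursion is well founded because `det-border` calls `det-column` only on minors, which are
  -- one size smaller.
  det-column {suc n} A = trans (det-border A) (sym (+-cong (*-congʳ (*-identityˡ _)) (trans
    (sumFin-cong {suc n} {λ i → - sg i * A (suc i) zero * det (minor A (suc i) zero)}
      (λ i → *-congˡ { - sg i * A (suc i) zero} (det-row (minor A (suc i) zero))))
    (sumFin-neg-product sg (λ i → A (suc i) zero) sg (λ j → A zero (suc j))
      (λ i j → det (minor (minor A zero zero) i j))))))
    where
    sg : Fin (suc n) → Carrier
    sg i = signPow (toℕ i)

  det-border {n} A = trans (det-row A) (+-cong (*-congʳ (*-identityˡ _)) (begin
    sumFin (λ j → - sg j * A zero (suc j) * det (minor A zero (suc j)))
      ≈⟨ sumFin-cong {suc n} {λ j → - sg j * A zero (suc j) * det (minor A zero (suc j))}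
           (λ j → *-congˡ { - sg j * A zero (suc j)} (det-column (minor A zero (suc j)))) ⟩
    sumFin (λ j → - sg j * A zero (suc j) * columnExpansion (minor A zero (suc j)))
      ≈⟨ sumFin-neg-product sg (λ j → A zero (suc j)) sg (λ i → A (suc i) zero)
           (λ j i → det (minor (minor A zero zero) i j)) ⟩
    - sumFin (λ j → sumFin (λ i → sg j * sg i * (A zero (suc j) * A (suc i) zero * D i j)))
      ≈⟨ -‿cong (sumFin-swap {suc n} {suc n} (λ j i → sg j * sg i * (A zero (suc j) * A (suc i) zero * D i j))) ⟩
    - sumFin (λ i → sumFin (λ j → sg j * sg i * (A zero (suc j) * A (suc i) zero * D i j)))
      ≈⟨ -‿cong (sumFin-cong {suc n} {g = λ i → sumFin (borderTerm A i)} (λ i →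
           sumFin-cong {suc n} {g = borderTerm A i} (λ j → *-cong (*-comm (sg j) (sg i))
             (*-congʳ (*-comm (A zero (suc j)) (A (suc i) zero)))))) ⟩
    - sumFin (λ i → sumFin (borderTerm A i)) ∎))
    where
    sg : Fin (suc n) → Carrier
    sg i = signPow (toℕ i)
    D : Fin (suc n) → Fin (suc n) → Carrier
    D i j = det (minor (minor A zero zero) i j)

  det-transpose : ∀ {n} (A : Matrix n) → det (λ i j → A j i) ≈ det A
  det-transpose {zero}  A = refl
  det-transpose {suc n} A = trans (det-row (λ i j → A j i)) (trans
    (sumFin-cong {suc n} (λ j → *-congˡ {signPow (toℕ j) * A j zero} (det-transpose (minor A j zero))))
    (sym (det-column A)))

  -- Exterior algebra and multiplicativity

  -- An element of the exterior algebra of Rⁿ, given by its coordinates: the vector of booleans s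
  -- stands for the basis element that is the product of the e_i with s_i = true, in order.
  Form : ℕ → Set c
  Form n = Vec Bool n → Carrier

  -- Left multiplication by the vector `a`. In a coordinate that contains e_0, either `a` supplies
  -- e_0, or e_0 is already in `ω` and the rest of `a` has to pass it, which costs the sign.
  wedge : ∀ {n} → Vector n → Form n → Form n
  wedge {zero}  a ω s           = 0#
  wedge {suc n} a ω (false ∷ s) = wedge (a ∘ suc) (ω ∘ (false ∷_)) s
  wedge {suc n} a ω (true  ∷ s) = a zero * ω (false ∷ s) - wedge (a ∘ suc) (ω ∘ (true ∷_)) s

  unit : ∀ {n} → Form n
  unit []          = 1#
  unit (false ∷ s) = unit s
  unit (true  ∷ s) = 0#

  wedge-cong : ∀ {n} {a b : Vector n} {ω η : Form n} → (∀ i → a i ≈ b i) → (∀ s → ω s ≈ η s) →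
    ∀ s → wedge a ω s ≈ wedge b η s
  wedge-cong {zero}  p q s           = refl
  wedge-cong {suc n} p q (false ∷ s) = wedge-cong (p ∘ suc) (q ∘ (false ∷_)) s
  wedge-cong {suc n} p q (true  ∷ s) =
    +-cong (*-cong (p zero) (q (false ∷ s))) (-‿cong (wedge-cong (p ∘ suc) (q ∘ (true ∷_)) s))

  wedge-linear : ∀ {n} (a : Vector n) x (ω η : Form n) s →
    wedge a (λ t → x * ω t + η t) s ≈ x * wedge a ω s + wedge a η s
  wedge-linear {zero}  a x ω η s           = solve 1 (λ x → con (+ 0) := x :* con (+ 0) :+ con (+ 0)) refl x
  wedge-linear {suc n} a x ω η (false ∷ s) = wedge-linear (a ∘ suc) x (ω ∘ (false ∷_)) (η ∘ (false ∷_)) s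
  wedge-linear {suc n} a x ω η (true  ∷ s) = trans
    (+-congˡ (-‿cong (wedge-linear (a ∘ suc) x (ω ∘ (true ∷_)) (η ∘ (true ∷_)) s)))
    (solve 6 (λ a x o h p q → a :* (x :* o :+ h) :- (x :* p :+ q) := x :* (a :* o :- p) :+ (a :* h :- q)) refl _ _ _ _ _ _)

  wedge-linearᵛ : ∀ {n} x (a b : Vector n) (ω : Form n) s →
    wedge (λ i → x * a i + b i) ω s ≈ x * wedge a ω s + wedge b ω s
  wedge-linearᵛ {zero}  x a b ω s           = solve 1 (λ x → con (+ 0) := x :* con (+ 0) :+ con (+ 0)) refl x
  wedge-linearᵛ {suc n} x a b ω (false ∷ s) = wedge-linearᵛ x (a ∘ suc) (b ∘ suc) (ω ∘ (false ∷_)) s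
  wedge-linearᵛ {suc n} x a b ω (true  ∷ s) = trans
    (+-congˡ (-‿cong (wedge-linearᵛ x (a ∘ suc) (b ∘ suc) (ω ∘ (true ∷_)) s)))
    (solve 6 (λ a x o b p q → (x :* a :+ b) :* o :- (x :* p :+ q) := x :* (a :* o :- p) :+ (b :* o :- q)) refl _ _ _ _ _ _)

  wedge-0 : ∀ {n} (a : Vector n) {ω : Form n} → (∀ s → ω s ≈ 0#) → ∀ s → wedge a ω s ≈ 0#
  wedge-0 {zero}  a z s           = refl
  wedge-0 {suc n} a z (false ∷ s) = wedge-0 (a ∘ suc) (z ∘ (false ∷_)) s
  wedge-0 {suc n} a z (true  ∷ s) = trans
    (+-cong (*-congˡ (z (false ∷ s))) (-‿cong (wedge-0 (a ∘ suc) (z ∘ (true ∷_)) s)))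
    (solve 1 (λ a → a :* con (+ 0) :- con (+ 0) := con (+ 0)) refl _)

  wedge-0ᵛ : ∀ {n} (ω : Form n) s → wedge (λ _ → 0#) ω s ≈ 0#
  wedge-0ᵛ {zero}  ω s           = refl
  wedge-0ᵛ {suc n} ω (false ∷ s) = wedge-0ᵛ (ω ∘ (false ∷_)) s
  wedge-0ᵛ {suc n} ω (true  ∷ s) = trans (+-congˡ (-‿cong (wedge-0ᵛ (ω ∘ (true ∷_)) s)))
    (solve 1 (λ a → con (+ 0) :* a :- con (+ 0) := con (+ 0)) refl _)

  wedge-sub : ∀ {n} (a : Vector n) x (ω η : Form n) s →
    wedge a (λ t → x * ω t - η t) s ≈ x * wedge a ω s - wedge a η s
  wedge-sub a x ω η s = begin
    wedge a (λ t → x * ω t - η t) s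
      ≈⟨ wedge-cong (λ _ → refl) (λ t → solve 3 (λ x o h → x :* o :- h := :- con (+ 1) :* h :+ x :* o) refl x (ω t) (η t)) s ⟩
    wedge a (λ t → - 1# * η t + x * ω t) s
      ≈⟨ wedge-linear a (- 1#) η (λ t → x * ω t) s ⟩
    - 1# * wedge a η s + wedge a (λ t → x * ω t) s
      ≈⟨ +-congˡ (wedge-cong (λ _ → refl) (λ t → sym (+-identityʳ _)) s) ⟩
    - 1# * wedge a η s + wedge a (λ t → x * ω t + 0#) s
      ≈⟨ +-congˡ (trans (wedge-linear a x ω (λ _ → 0#) s) (+-congˡ (wedge-0 a (λ _ → refl) s))) ⟩
    - 1# * wedge a η s + (x * wedge a ω s + 0#)
      ≈⟨ solve 3 (λ x o h → :- con (+ 1) :* h :+ (x :* o :+ con (+ 0)) := x :* o :- h) refl _ _ _ ⟩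
    x * wedge a ω s - wedge a η s ∎

  wedge-anticomm : ∀ {n} (a b : Vector n) (ω : Form n) s → wedge a (wedge b ω) s ≈ - wedge b (wedge a ω) s
  wedge-anticomm {zero}  a b ω s           = solve 0 (con (+ 0) := :- con (+ 0)) refl
  wedge-anticomm {suc n} a b ω (false ∷ s) = wedge-anticomm (a ∘ suc) (b ∘ suc) (ω ∘ (false ∷_)) s
  wedge-anticomm {suc n} a b ω (true  ∷ s) = begin
    a zero * wedge b′ ωf s - wedge a′ (λ t → b zero * ωf t - wedge b′ ωt t) s
      ≈⟨ +-congˡ (-‿cong (wedge-sub a′ (b zero) ωf (wedge b′ ωt) s)) ⟩
    a zero * wedge b′ ωf s - (b zero * wedge a′ ωf s - wedge a′ (wedge b′ ωt) s)
      ≈⟨ +-congˡ (-‿cong (+-congˡ (-‿cong (wedge-anticomm a′ b′ ωt s)))) ⟩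
    a zero * wedge b′ ωf s - (b zero * wedge a′ ωf s - - wedge b′ (wedge a′ ωt) s)
      ≈⟨ solve 5 (λ a p b q r → a :* p :- (b :* q :- :- r) := :- (b :* q :- (a :* p :- r))) refl _ _ _ _ _ ⟩
    - (b zero * wedge a′ ωf s - (a zero * wedge b′ ωf s - wedge b′ (wedge a′ ωt) s))
      ≈⟨ -‿cong (+-congˡ (-‿cong (wedge-sub b′ (a zero) ωf (wedge a′ ωt) s))) ⟨
    - (b zero * wedge a′ ωf s - wedge b′ (λ t → a zero * ωf t - wedge a′ ωt t) s) ∎
    where
    a′ = a ∘ suc
    b′ = b ∘ suc
    ωf = ω ∘ (false ∷_)
    ωt = ω ∘ (true ∷_)

  -- Proved by its own induction: anticommutativity yields only twice this identity, and 2 may be a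
  -- zero divisor.
  wedge-alternating : ∀ {n} (a : Vector n) (ω : Form n) s → wedge a (wedge a ω) s ≈ 0#
  wedge-alternating {zero}  a ω s           = refl
  wedge-alternating {suc n} a ω (false ∷ s) = wedge-alternating (a ∘ suc) (ω ∘ (false ∷_)) s
  wedge-alternating {suc n} a ω (true  ∷ s) = begin
    a zero * wedge a′ ωf s - wedge a′ (λ t → a zero * ωf t - wedge a′ ωt t) s
      ≈⟨ +-congˡ (-‿cong (trans (wedge-sub a′ (a zero) ωf (wedge a′ ωt) s) (+-congˡ (-‿cong (wedge-alternating a′ ωt s))))) ⟩
    a zero * wedge a′ ωf s - (a zero * wedge a′ ωf s - 0#)
      ≈⟨ solve 1 (λ p → p :- (p :- con (+ 0)) := con (+ 0)) refl _ ⟩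
    0# ∎
    where
    a′ = a ∘ suc
    ωf = ω ∘ (false ∷_)
    ωt = ω ∘ (true ∷_)

  infixl 7 _∙_
  _∙_ : ∀ {k n} → Vector k → (Fin k → Vector n) → Vector n
  (a ∙ B) j = sumFin (λ i → a i * B i j)

  -- The algebra homomorphism induced by the linear map that sends e_i to the i-th row of B.
  push : ∀ {k n} → (Fin k → Vector n) → Form k → Form n
  push {zero}  B ω s = ω [] * unit s
  push {suc k} B ω s = push (B ∘ suc) (ω ∘ (false ∷_)) s + wedge (B zero) (push (B ∘ suc) (ω ∘ (true ∷_))) s

  push-cong : ∀ {k n} (B : Fin k → Vector n) {ω η : Form k} → (∀ s → ω s ≈ η s) → ∀ s → push B ω s ≈ push B η s
  push-cong {zero}  B e s = *-congʳ (e [])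
  push-cong {suc k} B e s = +-cong (push-cong (B ∘ suc) (e ∘ (false ∷_)) s)
    (wedge-cong (λ _ → refl) (push-cong (B ∘ suc) (e ∘ (true ∷_))) s)

  push-0 : ∀ {k n} (B : Fin k → Vector n) {ω : Form k} → (∀ s → ω s ≈ 0#) → ∀ s → push B ω s ≈ 0#
  push-0 {zero}  B z s = trans (*-congʳ (z [])) (zeroˡ _)
  push-0 {suc k} B z s = trans (+-cong (push-0 (B ∘ suc) (z ∘ (false ∷_)) s)
    (wedge-0 (B zero) (push-0 (B ∘ suc) (z ∘ (true ∷_))) s)) (+-identityˡ 0#)

  push-sub : ∀ {k n} (B : Fin k → Vector n) x (ω η : Form k) s →
    push B (λ t → x * ω t - η t) s ≈ x * push B ω s - push B η s
  push-sub {zero}  B x ω η s = solve 4 (λ x o h u → (x :* o :- h) :* u := x :* (o :* u) :- h :* u) refl _ _ _ _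
  push-sub {suc k} B x ω η s = trans
    (+-cong (push-sub (B ∘ suc) x (ω ∘ (false ∷_)) (η ∘ (false ∷_)) s)
      (trans (wedge-cong (λ _ → refl) (push-sub (B ∘ suc) x (ω ∘ (true ∷_)) (η ∘ (true ∷_))) s)
             (wedge-sub (B zero) x _ _ s)))
    (solve 5 (λ x a b p q → (x :* a :- b) :+ (x :* p :- q) := x :* (a :+ p) :- (b :+ q)) refl _ _ _ _ _)

  -- Multiplicativity of the induced map on generators. With b the first row of `B`, the two
  -- relations of the exterior algebra enter: the remaining rows anticommute with b, and b ∧ b = 0.
  push-wedge : ∀ {k n} (B : Fin k → Vector n) a (ω : Form k) s →
    push B (wedge a ω) s ≈ wedge (a ∙ B) (push B ω) s
  push-wedge {zero}  B a ω s = trans (zeroˡ _) (sym (wedge-0ᵛ _ s))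
  push-wedge {suc k} B a ω s = begin
    push B′ (wedge a′ ωf) s + wedge b (push B′ (λ t → a zero * ωf t - wedge a′ ωt t)) s
      ≈⟨ +-cong (push-wedge B′ a′ ωf s)
           (wedge-cong (λ _ → refl) (λ t → trans (push-sub B′ (a zero) ωf (wedge a′ ωt) t)
             (+-congˡ (-‿cong (push-wedge B′ a′ ωt t)))) s) ⟩
    wedge d φ s + wedge b (λ t → a zero * φ t - wedge d ψ t) s
      ≈⟨ +-congˡ (wedge-sub b (a zero) φ (wedge d ψ) s) ⟩
    wedge d φ s + (a zero * wedge b φ s - wedge b (wedge d ψ) s)
      ≈⟨ +-congˡ (+-congˡ (-‿cong (wedge-anticomm b d ψ s))) ⟩
    wedge d φ s + (a zero * wedge b φ s - - wedge d (wedge b ψ) s)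
      -- The inserted `0#` stands for b ∧ b ∧ ψ; with it both groups become wedges with b ∧ ψ + φ,
      -- the image of `ω`.
      ≈⟨ solve 4 (λ p q r x → p :+ (q :* r :- :- x) := q :* (con (+ 1) :* con (+ 0) :+ r) :+ (con (+ 1) :* x :+ p)) refl _ _ _ _ ⟩
    a zero * (1# * 0# + wedge b φ s) + (1# * wedge d (wedge b ψ) s + wedge d φ s)
      ≈⟨ +-congʳ (*-congˡ (+-congʳ (*-congˡ (wedge-alternating b ψ s)))) ⟨
    a zero * (1# * wedge b (wedge b ψ) s + wedge b φ s) + (1# * wedge d (wedge b ψ) s + wedge d φ s)
      ≈⟨ +-cong (*-congˡ (wedge-linear b 1# (wedge b ψ) φ s)) (wedge-linear d 1# (wedge b ψ) φ s) ⟨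
    a zero * wedge b (λ t → 1# * wedge b ψ t + φ t) s + wedge d (λ t → 1# * wedge b ψ t + φ t) s
      ≈⟨ wedge-linearᵛ (a zero) b d (λ t → 1# * wedge b ψ t + φ t) s ⟨
    wedge (a ∙ B) (λ t → 1# * wedge b ψ t + φ t) s
      ≈⟨ wedge-cong (λ _ → refl) (λ t → trans (+-congʳ (*-identityˡ _)) (+-comm _ _)) s ⟩
    wedge (a ∙ B) (λ t → φ t + wedge b ψ t) s ∎
    where
    a′ = a ∘ suc
    B′ = B ∘ suc
    b  = B zero
    d  = a′ ∙ B′
    ωf = ω ∘ (false ∷_)
    ωt = ω ∘ (true ∷_)
    φ  = push B′ ωf
    ψ  = push B′ ωt

  push-unit : ∀ {k n} (B : Fin k → Vector n) s → push B unit s ≈ unit s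
  push-unit {zero}  B s = *-identityˡ _
  push-unit {suc k} B s = trans
    (+-cong (push-unit (B ∘ suc) s) (wedge-0 (B zero) (push-0 (B ∘ suc) (λ _ → refl)) s))
    (+-identityʳ _)

  wedges : ∀ {k n} → (Fin k → Vector n) → Form n
  wedges {zero}  A = unit
  wedges {suc k} A = wedge (A zero) (wedges (A ∘ suc))

  push-wedges : ∀ {k l n} (A : Fin k → Vector l) (B : Fin l → Vector n) s →
    push B (wedges A) s ≈ wedges (λ i → A i ∙ B) s
  push-wedges {zero}  A B s = push-unit B s
  push-wedges {suc k} A B s = trans (push-wedge B (A zero) (wedges (A ∘ suc)) s)
    (wedge-cong (λ _ → refl) (push-wedges (A ∘ suc) B) s)

  -- The top coordinate arises by supplying the one missing e_j; moving it past e_0, ..., e_{j-1}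
  -- gives the sign of the row expansion.
  wedge-top : ∀ {n} (a : Vector (suc n)) (ω : Form (suc n)) → wedge a ω (replicate (suc n) true) ≈
    sumFin (λ j → signPow (toℕ j) * a j * ω (insertAt (replicate n true) j false))
  wedge-top {zero}  a ω = solve 2 (λ x y → x :* y :- con (+ 0) := con (+ 1) :* x :* y :+ con (+ 0)) refl _ _
  wedge-top {suc n} a ω = +-cong (*-congʳ (sym (*-identityˡ _)))
    (trans (-‿cong (wedge-top (a ∘ suc) (ω ∘ (true ∷_)))) (trans
      (sym (sumFin-neg {suc n} term))
      (sumFin-cong {suc n} {λ j → - term j} (λ j → solve 3 (λ x y z → :- (x :* y :* z) := :- x :* y :* z) refl
        (signPow (toℕ j)) (a (suc j)) (ω (true ∷ insertAt (replicate n true) j false))))))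
    where
    term : Fin (suc n) → Carrier
    term j = signPow (toℕ j) * a (suc j) * ω (true ∷ insertAt (replicate n true) j false)

  -- Setting e_j to zero is compatible with products. This turns the coordinates in which e_j is
  -- missing into products of rows with column `j` deleted, that is, into minors.
  wedge-insertAt-false : ∀ {n} (a : Vector (suc n)) (ω : Form (suc n)) j s →
    wedge a ω (insertAt s j false) ≈ wedge (a ∘ punchIn j) (λ t → ω (insertAt t j false)) s
  wedge-insertAt-false a ω zero    s           = refl
  wedge-insertAt-false a ω (suc j) (false ∷ s) = wedge-insertAt-false (a ∘ suc) (ω ∘ (false ∷_)) j s
  wedge-insertAt-false a ω (suc j) (true  ∷ s) =
    +-congˡ (-‿cong (wedge-insertAt-false (a ∘ suc) (ω ∘ (true ∷_)) j s))

  unit-insertAt-false : ∀ {n} (s : Vec Bool n) j → unit (insertAt s j false) ≈ unit s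
  unit-insertAt-false s           zero    = refl
  unit-insertAt-false (false ∷ s) (suc j) = unit-insertAt-false s j
  unit-insertAt-false (true  ∷ s) (suc j) = refl

  wedges-insertAt-false : ∀ {k n} (A : Fin k → Vector (suc n)) j s →
    wedges A (insertAt s j false) ≈ wedges (λ i → A i ∘ punchIn j) s
  wedges-insertAt-false {zero}  A j s = unit-insertAt-false s j
  wedges-insertAt-false {suc k} A j s = trans (wedge-insertAt-false (A zero) _ j s)
    (wedge-cong (λ _ → refl) (wedges-insertAt-false (A ∘ suc) j) s)

  wedges-top : ∀ {n} (A : Matrix n) → wedges A (replicate n true) ≈ det A
  wedges-top {zero}  A = solve 0 (con (+ 1) := con (+ 1) :* con (+ 1) :+ con (+ 0)) refl
  wedges-top {suc n} A = trans (wedge-top (A zero) (wedges (A ∘ suc))) (trans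
    (sumFin-cong {suc n} (λ j → *-congˡ {signPow (toℕ j) * A zero j} (trans
      (wedges-insertAt-false (A ∘ suc) j (replicate n true)) (wedges-top (minor A zero j)))))
    (sym (det-row A)))

  wedge-degree : ∀ {n} k (a : Vector n) {ω : Form n} → (∀ s → degree s < k → ω s ≈ 0#) →
    ∀ s → degree s < suc k → wedge a ω s ≈ 0#
  wedge-degree {zero}  k       a z s           p       = refl
  wedge-degree {suc n} k       a z (false ∷ s) p       = wedge-degree k (a ∘ suc) (z ∘ (false ∷_)) s p
  wedge-degree {suc n} (suc k) a z (true  ∷ s) (s≤s p) = trans
    (+-cong (*-congˡ (z (false ∷ s) p)) (-‿cong (wedge-degree k (a ∘ suc) (λ t q → z (true ∷ t) (s≤s q)) s p)))
    (solve 1 (λ x → x :* con (+ 0) :- con (+ 0) := con (+ 0)) refl _)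

  wedges-degree : ∀ {k n} (A : Fin k → Vector n) s → degree s < k → wedges A s ≈ 0#
  wedges-degree {suc k} A = wedge-degree k (A zero) (wedges-degree (A ∘ suc))

  -- A form on `k` generators without components of degree below `k` is a multiple of e_0 ∧ ... ∧
  -- e_{k-1}, and this element is sent to the product of the rows of `B`.
  push-top : ∀ {k n} (B : Fin k → Vector n) {ω : Form k} → (∀ s → degree s < k → ω s ≈ 0#) →
    ∀ s → push B ω s ≈ ω (replicate k true) * wedges B s
  push-top {zero}  B z s = refl
  push-top {suc k} B {ω} z s = begin
    push B′ ωf s + wedge (B zero) (push B′ (ω ∘ (true ∷_))) s
      ≈⟨ +-cong (push-0 B′ (λ t → z (false ∷ t) (s≤s (degree≤n t))) s)
           (wedge-cong (λ _ → refl) (λ t → trans (push-top B′ (λ t p → z (true ∷ t) (s≤s p)) t) (sym (+-identityʳ _))) s) ⟩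
    0# + wedge (B zero) (λ t → top * wedges B′ t + 0#) s
      ≈⟨ +-congˡ (trans (wedge-linear (B zero) top (wedges B′) (λ _ → 0#) s) (+-congˡ (wedge-0 (B zero) (λ _ → refl) s))) ⟩
    0# + (top * wedges B s + 0#)
      ≈⟨ trans (+-identityˡ _) (+-identityʳ _) ⟩
    top * wedges B s ∎
    where
    B′  = B ∘ suc
    ωf  = ω ∘ (false ∷_)
    top = ω (replicate (suc k) true)

  det-∙ : ∀ {n} (A B : Matrix n) → det (λ i → A i ∙ B) ≈ det A * det B
  det-∙ {n} A B = begin
    det (λ i → A i ∙ B)               ≈⟨ wedges-top (λ i → A i ∙ B) ⟨
    wedges (λ i → A i ∙ B) ones       ≈⟨ push-wedges A B ones ⟨
    push B (wedges A) ones            ≈⟨ push-top B (wedges-degree A) ones ⟩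
    wedges A ones * wedges B ones     ≈⟨ *-cong (wedges-top A) (wedges-top B) ⟩
    det A * det B                     ∎
    where ones = replicate n true

  -- Permanents of matrices of rank two

  fromℕ-+ : ∀ m n → fromℕ (m ℕ.+ n) ≈ fromℕ m + fromℕ n
  fromℕ-+ zero    n = sym (+-identityˡ _)
  fromℕ-+ (suc m) n = trans (+-congˡ (fromℕ-+ m n)) (sym (+-assoc _ _ _))

  fromℕ-* : ∀ m n → fromℕ (m ℕ.* n) ≈ fromℕ m * fromℕ n
  fromℕ-* zero    n = sym (zeroˡ _)
  fromℕ-* (suc m) n = trans (fromℕ-+ n (m ℕ.* n)) (trans (+-congˡ (fromℕ-* m n))
    (solve 2 (λ x y → y :+ x :* y := (con (+ 1) :+ x) :* y) refl _ _))

  fromℕ-cong : ∀ {m n} → m ≡ n → fromℕ m ≈ fromℕ n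
  fromℕ-cong e = reflexive (≡.cong fromℕ e)

  -- Multiplication by t on coefficient sequences.
  shift : (ℕ → Carrier) → ℕ → Carrier
  shift f zero    = 0#
  shift f (suc k) = f k

  -- The coefficient of tᵏ in ∏ᵢ (vᵢ t + uᵢ).
  coefficient : ∀ {n} → Vector n → Vector n → ℕ → Carrier
  coefficient {zero}  v u zero    = 1#
  coefficient {zero}  v u (suc k) = 0#
  coefficient {suc n} v u k       =
    v zero * shift (coefficient (v ∘ suc) (u ∘ suc)) k + u zero * coefficient (v ∘ suc) (u ∘ suc) k

  coefficient-omit : ∀ {n} → Vector (suc n) → Vector (suc n) → Fin (suc n) → ℕ → Carrier
  coefficient-omit v u i = coefficient (v ∘ punchIn i) (u ∘ punchIn i)

  coefficient-split : ∀ {n} (v u : Vector (suc n)) i k →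
    coefficient v u k ≈ v i * shift (coefficient-omit v u i) k + u i * coefficient-omit v u i k
  coefficient-split         v u zero    k = refl
  coefficient-split {suc n} v u (suc i) zero = trans
    (+-congˡ (*-congˡ (coefficient-split (v ∘ suc) (u ∘ suc) i zero)))
    (solve 5 (λ a b p q r → p :* con (+ 0) :+ q :* (a :* con (+ 0) :+ b :* r)
        := a :* con (+ 0) :+ b :* (p :* con (+ 0) :+ q :* r)) refl _ _ _ _ _)
  coefficient-split {suc n} v u (suc i) (suc k) = trans
    (+-cong (*-congˡ (coefficient-split (v ∘ suc) (u ∘ suc) i k))
            (*-congˡ (coefficient-split (v ∘ suc) (u ∘ suc) i (suc k))))
    (solve 7 (λ a b p q r s t → p :* (a :* r :+ b :* s) :+ q :* (a :* s :+ b :* t)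
        := a :* (p :* r :+ q :* s) :+ b :* (p :* s :+ q :* t)) refl _ _ _ _ _ _ _)

  coefficient-vanish : ∀ {n} (v u : Vector n) k → n < k → coefficient v u k ≈ 0#
  coefficient-vanish {zero}  v u (suc k) p       = refl
  coefficient-vanish {suc n} v u (suc k) (s≤s p) = trans
    (+-cong (*-congˡ (coefficient-vanish (v ∘ suc) (u ∘ suc) k p))
            (*-congˡ (coefficient-vanish (v ∘ suc) (u ∘ suc) (suc k) (ℕ.m<n⇒m<1+n p))))
    (solve 2 (λ x y → x :* con (+ 0) :+ y :* con (+ 0) := con (+ 0)) refl _ _)

  -- The product rule: ∑ᵢ vᵢ ∏_{j ≠ i} (vⱼ t + uⱼ) is the derivative of ∏ᵢ (vᵢ t + uᵢ). The
  -- companion `sum-v-shift-omit` is the same for t times the derivative.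
  sum-v-omit : ∀ {n} (v u : Vector (suc n)) k →
    sumFin (λ i → v i * coefficient-omit v u i k) ≈ fromℕ (suc k) * coefficient v u (suc k)
  sum-v-shift-omit : ∀ {n} (v u : Vector (suc n)) k →
    sumFin (λ i → v i * shift (coefficient-omit v u i) k) ≈ fromℕ k * coefficient v u k

  sum-v-omit {zero} v u zero =
    solve 2 (λ v u → v :* con (+ 1) :+ con (+ 0) := (con (+ 1) :+ con (+ 0)) :* (v :* con (+ 1) :+ u :* con (+ 0))) refl _ _
  sum-v-omit {zero} v u (suc k) =
    solve 3 (λ v u n → v :* con (+ 0) :+ con (+ 0) := n :* (v :* con (+ 0) :+ u :* con (+ 0))) refl _ _ _
  sum-v-omit {suc n} v u k = begin
    v₀ * p k + sumFin (λ i → v′ i * (v₀ * shift (r i) k + u₀ * r i k))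
      ≈⟨ +-congˡ (sumFin-cong {suc n} {g = λ i → v₀ * (v′ i * shift (r i) k) + u₀ * (v′ i * r i k)} (λ i →
           solve 5 (λ x a s b t → x :* (a :* s :+ b :* t) := a :* (x :* s) :+ b :* (x :* t)) refl
             (v′ i) v₀ (shift (r i) k) u₀ (r i k))) ⟩
    v₀ * p k + sumFin (λ i → v₀ * (v′ i * shift (r i) k) + u₀ * (v′ i * r i k))
      ≈⟨ +-congˡ (trans (sumFin-+ {suc n} (λ i → v₀ * (v′ i * shift (r i) k)) (λ i → u₀ * (v′ i * r i k)))
           (+-cong (sumFin-*ˡ {suc n} v₀ (λ i → v′ i * shift (r i) k)) (sumFin-*ˡ {suc n} u₀ (λ i → v′ i * r i k)))) ⟩
    v₀ * p k + (v₀ * sumFin (λ i → v′ i * shift (r i) k) + u₀ * sumFin (λ i → v′ i * r i k))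
      ≈⟨ +-congˡ (+-cong (*-congˡ (sum-v-shift-omit v′ u′ k)) (*-congˡ (sum-v-omit v′ u′ k))) ⟩
    v₀ * p k + (v₀ * (fromℕ k * p k) + u₀ * (fromℕ (suc k) * p (suc k)))
      ≈⟨ solve 5 (λ v u n x y → v :* x :+ (v :* (n :* x) :+ u :* ((con (+ 1) :+ n) :* y))
           := (con (+ 1) :+ n) :* (v :* x :+ u :* y)) refl _ _ _ _ _ ⟩
    fromℕ (suc k) * (v₀ * p k + u₀ * p (suc k)) ∎
    where
    v₀ = v zero
    u₀ = u zero
    v′ = v ∘ suc
    u′ = u ∘ suc
    p  = coefficient v′ u′
    r  = coefficient-omit v′ u′

  sum-v-shift-omit {n} v u zero    = trans (sumFin-0 {suc n} {λ i → v i * 0#} (λ i → zeroʳ _)) (sym (zeroˡ _))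
  sum-v-shift-omit     v u (suc k) = sum-v-omit v u k

  sumFin-const : ∀ n x → sumFin {n} (λ _ → x) ≈ fromℕ n * x
  sumFin-const zero    x = sym (zeroˡ _)
  sumFin-const (suc n) x = trans (+-congˡ (sumFin-const n x))
    (solve 2 (λ n x → x :+ n :* x := (con (+ 1) :+ n) :* x) refl _ _)

  -- Summing `coefficient-split` over all `suc n` indices counts E_k `suc n` times; the v-part
  -- accounts for `k` of these by the product rule.
  sum-u-omit : ∀ {n} (v u : Vector (suc n)) k → k ≤ n →
    sumFin (λ i → u i * coefficient-omit v u i k) ≈ fromℕ (suc (n ∸ k)) * coefficient v u k
  sum-u-omit {n} v u k k≤n = begin
    S                                ≈⟨ solve 2 (λ s t → s := (t :+ s) :- t) refl _ _ ⟩
    (T + S) - T                      ≈⟨ +-cong (sym (sumFin-+ {suc n} (λ i → v i * shift (r i) k) (λ i → u i * r i k))) (-‿cong (sum-v-shift-omit v u k)) ⟩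
    sumFin (λ i → v i * shift (r i) k + u i * r i k) - fromℕ k * C
                                     ≈⟨ +-congʳ (sumFin-cong {suc n} {g = λ _ → C} (λ i → sym (coefficient-split v u i k))) ⟩
    sumFin {suc n} (λ _ → C) - fromℕ k * C
                                     ≈⟨ +-congʳ (trans (sumFin-const (suc n) C) (*-congʳ total)) ⟩
    (fromℕ (suc (n ∸ k)) + fromℕ k) * C - fromℕ k * C
                                     ≈⟨ solve 3 (λ a b c → (a :+ b) :* c :- b :* c := a :* c) refl _ _ _ ⟩
    fromℕ (suc (n ∸ k)) * C          ∎
    where
    r = coefficient-omit v u
    C = coefficient v u k
    S = sumFin (λ i → u i * r i k)
    T = sumFin (λ i → v i * shift (r i) k)
    total : fromℕ (suc n) ≈ fromℕ (suc (n ∸ k)) + fromℕ k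
    total = trans (fromℕ-cong (≡.sym (≡.cong suc (ℕ.m∸n+n≡m k≤n)))) (fromℕ-+ (suc (n ∸ k)) k)

  rankTwo : ∀ {n} → (v u w z : Vector n) → Matrix n
  rankTwo v u w z i j = v i * w j + u i * z j

  weight : ℕ → ℕ → Carrier
  weight n k = fromℕ (factorialWeight n k)

  -- Induction along the first row. The sum over the deleted column turns F_k(j) into (k+1) F_{k+1}
  -- or (n+1-k) F_k, and these factors are the ratios of consecutive weights.
  per-rankTwo : ∀ {n} (v u w z : Vector n) → per (rankTwo v u w z) ≈
    sumFin {suc n} (λ k → weight n (toℕ k) * (coefficient v u (toℕ k) * coefficient w z (toℕ k)))
  per-rankTwo {zero} v u w z =
    solve 0 (con (+ 1) :+ con (+ 0) := (con (+ 1) :+ con (+ 0)) :* (con (+ 1) :* con (+ 1)) :+ con (+ 0)) refl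
  per-rankTwo {suc n} v u w z = begin
    per (rankTwo v u w z)
      ≈⟨ per-row (rankTwo v u w z) ⟩
    sumFin {suc n} (λ j → (v₀ * w j + u₀ * z j) * per (rankTwo v′ u′ (w ∘ punchIn j) (z ∘ punchIn j)))
      ≈⟨ sumFin-cong {suc n} (λ j → trans
           (*-congˡ {v₀ * w j + u₀ * z j} (per-rankTwo v′ u′ (w ∘ punchIn j) (z ∘ punchIn j)))
           (sym (sumFin-*ˡ {suc n} (v₀ * w j + u₀ * z j) (λ k → weight n (toℕ k) * (e (toℕ k) * f j (toℕ k)))))) ⟩
    sumFin {suc n} (λ j → sumFin {suc n} (λ k → (v₀ * w j + u₀ * z j) * (weight n (toℕ k) * (e (toℕ k) * f j (toℕ k)))))
      ≈⟨ sumFin-swap {suc n} {suc n} (λ j k → (v₀ * w j + u₀ * z j) * (weight n (toℕ k) * (e (toℕ k) * f j (toℕ k)))) ⟩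
    sumFin {suc n} (λ k → sumFin {suc n} (λ j → (v₀ * w j + u₀ * z j) * (weight n (toℕ k) * (e (toℕ k) * f j (toℕ k)))))
      ≈⟨ sumFin-cong {suc n} (λ k → perColumn (toℕ k) (Fin.toℕ≤pred[n] k)) ⟩
    sumFin {suc n} (λ k → vTerm (suc (toℕ k)) + uTerm (toℕ k))
      ≈⟨ sumFin-+ {suc n} (λ k → vTerm (suc (toℕ k))) (λ k → uTerm (toℕ k)) ⟩
    sumFin {suc n} (λ k → vTerm (suc (toℕ k))) + sumFin {suc n} (λ k → uTerm (toℕ k))
      ≈⟨ +-cong first last ⟩
    sumFin {suc (suc n)} (λ k → vTerm (toℕ k)) + sumFin {suc (suc n)} (λ k → uTerm (toℕ k))
      ≈⟨ sumFin-+ {suc (suc n)} (λ k → vTerm (toℕ k)) (λ k → uTerm (toℕ k)) ⟨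
    sumFin {suc (suc n)} (λ k → vTerm (toℕ k) + uTerm (toℕ k))
      ≈⟨ sumFin-cong {suc (suc n)} (λ k → solve 6 (λ n v s u e f → n :* (v :* s :* f) :+ n :* (u :* e :* f)
           := n :* ((v :* s :+ u :* e) :* f)) refl (weight (suc n) (toℕ k)) v₀ (shift e (toℕ k)) u₀ (e (toℕ k)) (F (toℕ k))) ⟩
    sumFin {suc (suc n)} (λ k → weight (suc n) (toℕ k) * (coefficient v u (toℕ k) * F (toℕ k))) ∎
    where
    v₀ = v zero
    u₀ = u zero
    v′ = v ∘ suc
    u′ = u ∘ suc
    e  = coefficient v′ u′
    f  = coefficient-omit w z
    F  = coefficient w z
    vTerm uTerm : ℕ → Carrier
    vTerm k = weight (suc n) k * (v₀ * shift e k * F k)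
    uTerm k = weight (suc n) k * (u₀ * e k * F k)
    -- Both index ranges grow by one: the new v-term at 0 vanishes by `shift`, the new u-term at
    -- `suc n` because `e` has degree at most `n`.
    first : sumFin {suc n} (λ k → vTerm (suc (toℕ k))) ≈ sumFin {suc (suc n)} (λ k → vTerm (toℕ k))
    first = solve 4 (λ s n v f → s := n :* (v :* con (+ 0) :* f) :+ s) refl _ (weight (suc n) 0) v₀ (F 0)
    last : sumFin {suc n} (λ k → uTerm (toℕ k)) ≈ sumFin {suc (suc n)} (λ k → uTerm (toℕ k))
    last = sym (trans (sumFin-last (suc n) uTerm) (trans
      (+-congˡ (*-congˡ (*-congʳ (*-congˡ (coefficient-vanish v′ u′ (suc n) ℕ.≤-refl)))))
      (solve 4 (λ s n u f → s :+ n :* (u :* con (+ 0) :* f) := s) refl _ _ _ _)))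
    perColumn : ∀ k → k ≤ n →
      sumFin {suc n} (λ j → (v₀ * w j + u₀ * z j) * (weight n k * (e k * f j k))) ≈ vTerm (suc k) + uTerm k
    perColumn k k≤n = begin
      sumFin {suc n} (λ j → (v₀ * w j + u₀ * z j) * (weight n k * (e k * f j k)))
        ≈⟨ sumFin-cong {suc n} (λ j → solve 7 (λ v w u z n e f → (v :* w :+ u :* z) :* (n :* (e :* f))
             := n :* e :* v :* (w :* f) :+ n :* e :* u :* (z :* f)) refl v₀ (w j) u₀ (z j) (weight n k) (e k) (f j k)) ⟩
      sumFin {suc n} (λ j → weight n k * e k * v₀ * (w j * f j k) + weight n k * e k * u₀ * (z j * f j k))
        ≈⟨ sumFin-+ {suc n} (λ j → weight n k * e k * v₀ * (w j * f j k)) (λ j → weight n k * e k * u₀ * (z j * f j k)) ⟩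
      sumFin {suc n} (λ j → weight n k * e k * v₀ * (w j * f j k)) + sumFin {suc n} (λ j → weight n k * e k * u₀ * (z j * f j k))
        ≈⟨ +-cong (trans (sumFin-*ˡ {suc n} (weight n k * e k * v₀) (λ j → w j * f j k)) (*-congˡ (sum-v-omit w z k)))
                  (trans (sumFin-*ˡ {suc n} (weight n k * e k * u₀) (λ j → z j * f j k)) (*-congˡ (sum-u-omit w z k k≤n))) ⟩
      weight n k * e k * v₀ * (fromℕ (suc k) * F (suc k)) + weight n k * e k * u₀ * (fromℕ (suc (n ∸ k)) * F k)
        ≈⟨ solve 8 (λ n e v p f u q g → n :* e :* v :* (p :* f) :+ n :* e :* u :* (q :* g)
             := p :* n :* (v :* e :* f) :+ q :* n :* (u :* e :* g)) refl _ _ _ _ _ _ _ _ ⟩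
      fromℕ (suc k) * weight n k * (v₀ * e k * F (suc k)) + fromℕ (suc (n ∸ k)) * weight n k * (u₀ * e k * F k)
        ≈⟨ +-cong (*-congʳ (trans (fromℕ-cong (factorialWeight-suc n k)) (fromℕ-* (suc k) (factorialWeight n k))))
                  (*-congʳ (trans (fromℕ-cong (factorialWeight-sucˡ k≤n)) (fromℕ-* (suc (n ∸ k)) (factorialWeight n k)))) ⟨
      vTerm (suc k) + uTerm k ∎

  -- Bordered diagonal matrices

  det-firstRow : ∀ {n} (A : Matrix (suc n)) → (∀ j → A zero (suc j) ≈ 0#) →
    det A ≈ A zero zero * det (minor A zero zero)
  det-firstRow {n} A z = trans (det-row A) (trans
    (+-congˡ (sumFin-0 {n} (λ j → trans (*-congʳ (trans (*-congˡ (z j)) (zeroʳ _))) (zeroˡ _))))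
    (solve 2 (λ x y → con (+ 1) :* x :* y :+ con (+ 0) := x :* y) refl _ _))

  det-firstColumn : ∀ {n} (A : Matrix (suc n)) → (∀ i → A (suc i) zero ≈ 0#) →
    det A ≈ A zero zero * det (minor A zero zero)
  det-firstColumn {n} A z = trans (det-column A) (trans
    (+-congˡ (sumFin-0 {n} (λ i → trans (*-congʳ (trans (*-congˡ (z i)) (zeroʳ _))) (zeroˡ _))))
    (solve 2 (λ x y → con (+ 1) :* x :* y :+ con (+ 0) := x :* y) refl _ _))

  -- Recursive, so that deleting the first row and column reduces by computation to
  -- `diagonal (d ∘ suc)`.
  diagonal : ∀ {n} → Vector n → Matrix n
  diagonal d zero    zero    = d zero
  diagonal d zero    (suc j) = 0#
  diagonal d (suc i) zero    = 0#
  diagonal d (suc i) (suc j) = diagonal (d ∘ suc) i j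

  sum-diagonalˡ : ∀ {n} (d x : Vector n) i → sumFin (λ j → diagonal d i j * x j) ≈ d i * x i
  sum-diagonalˡ {suc n} d x zero    = trans (+-congˡ (sumFin-0 {n} (λ j → zeroˡ _))) (+-identityʳ _)
  sum-diagonalˡ {suc n} d x (suc i) =
    trans (+-cong (zeroˡ _) (sum-diagonalˡ (d ∘ suc) (x ∘ suc) i)) (+-identityˡ _)

  sum-diagonalʳ : ∀ {n} (d x : Vector n) j → sumFin (λ i → x i * diagonal d i j) ≈ x j * d j
  sum-diagonalʳ {suc n} d x zero    = trans (+-congˡ (sumFin-0 {n} (λ j → zeroʳ _))) (+-identityʳ _)
  sum-diagonalʳ {suc n} d x (suc j) =
    trans (+-cong (zeroʳ _) (sum-diagonalʳ (d ∘ suc) (x ∘ suc) j)) (+-identityˡ _)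

  det-diagonal : ∀ {n} (d : Vector n) → det (diagonal d) ≈ prodFin d
  det-diagonal {zero}  d = solve 0 (con (+ 1) :* con (+ 1) :+ con (+ 0) := con (+ 1)) refl
  det-diagonal {suc n} d = trans (det-firstRow (diagonal d) (λ _ → refl)) (*-congˡ (det-diagonal (d ∘ suc)))

  arrow : ∀ {n} → Carrier → (r c d : Vector n) → Matrix (suc n)
  arrow s r c d zero    zero    = s
  arrow s r c d zero    (suc j) = r j
  arrow s r c d (suc i) zero    = c i
  arrow s r c d (suc i) (suc j) = diagonal d i j

  -- ∑ᵢ tᵢ ∏_{j ≠ i} dⱼ
  derivation : ∀ {n} → (d t : Vector n) → Carrier
  derivation {zero}  d t = 0#
  derivation {suc n} d t = t zero * prodFin (d ∘ suc) + d zero * derivation (d ∘ suc) (t ∘ suc)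

  -- The Schur complement formula with denominators cleared. In the border expansion the minors of
  -- the diagonal block with `i ≠ j` vanish, each being reduced to one with a zero row or column.
  det-arrow : ∀ {n} s (r c d : Vector (suc n)) →
    det (arrow s r c d) ≈ s * prodFin d - derivation d (λ i → r i * c i)
  det-arrow {n} s r c d = trans (det-border (arrow s r c d))
    (+-cong (*-congˡ (det-diagonal d)) (-‿cong (cross-terms r c d)))
    where
    cross : ∀ {n} (r c d : Vector (suc n)) (i j : Fin (suc n)) → Carrier
    cross r c d i j = signPow (toℕ i) * signPow (toℕ j) * (c i * r j * det (minor (diagonal d) i j))
    vanish : ∀ {x y z} → z ≈ 0# → x * (y * z) ≈ 0#
    vanish z≈0 = trans (*-congˡ (trans (*-congˡ z≈0) (zeroʳ _))) (zeroʳ _)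
    cross-terms : ∀ {n} (r c d : Vector (suc n)) →
      sumFin (λ i → sumFin (cross r c d i)) ≈ derivation d (λ i → r i * c i)
    cross-terms {zero} r c d =
      solve 3 (λ r c d → con (+ 1) :* con (+ 1) :* (c :* r :* (con (+ 1) :* con (+ 1) :+ con (+ 0))) :+ con (+ 0) :+ con (+ 0)
        := r :* c :* con (+ 1) :+ d :* con (+ 0)) refl (r zero) (c zero) (d zero)
    cross-terms {suc n} r c d = begin
      (cross r c d zero zero + sumFin (λ j → cross r c d zero (suc j))) +
      sumFin (λ i → cross r c d (suc i) zero + sumFin (λ j → cross r c d (suc i) (suc j)))
        ≈⟨ +-cong
             (+-cong (*-congˡ {1# * 1#} (*-congˡ {c zero * r zero} (det-diagonal (d ∘ suc))))
                     (sumFin-0 {suc n} {λ j → cross r c d zero (suc j)} (λ j → vanish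
                       (trans (det-firstColumn (minor (diagonal d) zero (suc j)) (λ _ → refl)) (zeroˡ _)))))
             (sumFin-cong {suc n} {λ i → cross r c d (suc i) zero + sumFin (λ j → cross r c d (suc i) (suc j))} (λ i → +-cong
               (vanish {signPow (toℕ (suc i)) * 1#} (trans (det-firstRow (minor (diagonal d) (suc i) zero) (λ _ → refl)) (zeroˡ _)))
               (trans (sumFin-cong {suc n} {λ j → cross r c d (suc i) (suc j)} (λ j → trans
                         (*-congˡ { - signPow (toℕ i) * - signPow (toℕ j)} (*-congˡ {c (suc i) * r (suc j)}
                           (det-firstRow (minor (diagonal d) (suc i) (suc j)) (λ _ → refl))))
                         (solve 6 (λ s t x y e D → :- s :* :- t :* (x :* y :* (e :* D)) := e :* (s :* t :* (x :* y :* D))) refl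
                           (signPow (toℕ i)) (signPow (toℕ j)) (c (suc i)) (r (suc j)) (d zero) (det (minor (diagonal (d ∘ suc)) i j)))))
                      (sumFin-*ˡ {suc n} (d zero) (cross (r ∘ suc) (c ∘ suc) (d ∘ suc) i))))) ⟩
      (1# * 1# * (c zero * r zero * prodFin (d ∘ suc)) + 0#) +
      sumFin (λ i → 0# + d zero * sumFin (cross (r ∘ suc) (c ∘ suc) (d ∘ suc) i))
        ≈⟨ +-congˡ (trans (sumFin-cong {suc n} {λ i → 0# + d zero * sumFin (cross (r ∘ suc) (c ∘ suc) (d ∘ suc) i)} (λ i → +-identityˡ _))
             (trans (sumFin-*ˡ {suc n} (d zero) (λ i → sumFin (cross (r ∘ suc) (c ∘ suc) (d ∘ suc) i)))
               (*-congˡ (cross-terms (r ∘ suc) (c ∘ suc) (d ∘ suc))))) ⟩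
      (1# * 1# * (c zero * r zero * prodFin (d ∘ suc)) + 0#) + d zero * derivation (d ∘ suc) (λ i → r (suc i) * c (suc i))
        ≈⟨ solve 4 (λ r c p q → (con (+ 1) :* con (+ 1) :* (c :* r :* p) :+ con (+ 0)) :+ q := r :* c :* p :+ q) refl _ _ _ _ ⟩
      r zero * c zero * prodFin (d ∘ suc) + d zero * derivation (d ∘ suc) (λ i → r (suc i) * c (suc i)) ∎

  derivation-cong : ∀ {n} {d e s t : Vector n} → (∀ i → d i ≈ e i) → (∀ i → s i ≈ t i) → derivation d s ≈ derivation e t
  derivation-cong {zero}  p q = refl
  derivation-cong {suc n} p q = +-cong (*-cong (q zero) (prodFin-cong {n} (p ∘ suc)))
    (*-cong (p zero) (derivation-cong (p ∘ suc) (q ∘ suc)))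

  power : Carrier → ℕ → Carrier
  power x n = prodFin {n} (λ _ → x)

  -- Each summand carries every gᵢ once, one from `t` and the others from `d`, but one factor `x`
  -- fewer than the full product.
  derivation-scaled : ∀ {n} x (g t : Vector (suc n)) →
    derivation (λ i → x * g i) (λ i → g i * t i) ≈ power x n * prodFin g * sumFin t
  derivation-scaled {zero} x g t =
    solve 3 (λ x g t → g :* t :* con (+ 1) :+ x :* g :* con (+ 0) := con (+ 1) :* (g :* con (+ 1)) :* (t :+ con (+ 0))) refl _ _ _
  derivation-scaled {suc n} x g t = trans
    (+-cong (*-congˡ (prodFin-* {suc n} (λ _ → x) (g ∘ suc))) (*-congˡ (derivation-scaled x (g ∘ suc) (t ∘ suc))))
    (solve 6 (λ g t x p q s → g :* t :* (x :* p :* q) :+ x :* g :* (p :* q :* s) := x :* p :* (g :* q) :* (t :+ s)) refl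
      (g zero) (t zero) x (power x n) (prodFin (g ∘ suc)) (sumFin (t ∘ suc)))

  -- The determinants of the coefficient matrices

  pairProduct : ∀ {n} → Vector n → Vector n → Carrier
  pairProduct {zero}  v u = 1#
  pairProduct {suc n} v u = prodFin (λ j → v zero * u (suc j) - v (suc j) * u zero) * pairProduct (v ∘ suc) (u ∘ suc)

  -- Row `i` lists the coefficients of tⁱ (a t + b), so the matrix is multiplication by a t + b.
  bidiagonal : Carrier → Carrier → ∀ {n} → Fin n → Fin (suc n) → Carrier
  bidiagonal a b zero    zero          = b
  bidiagonal a b zero    (suc zero)    = a
  bidiagonal a b zero    (suc (suc k)) = 0#
  bidiagonal a b (suc i) zero          = 0#
  bidiagonal a b (suc i) (suc k)       = bidiagonal a b i k

  -- The rows reach only `f 0`, ..., `f (n - 1)`, while column `n` of the product with a t + b also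
  -- contains b times `f n`; hence the hypothesis.
  sum-bidiagonal : ∀ a b n (f : ℕ → Carrier) → f n ≈ 0# → (k : Fin (suc n)) →
    sumFin {n} (λ i → f (toℕ i) * bidiagonal a b i k) ≈ a * shift f (toℕ k) + b * f (toℕ k)
  sum-bidiagonal a b zero    f z zero    =
    sym (trans (+-congˡ (*-congˡ z)) (solve 2 (λ a b → a :* con (+ 0) :+ b :* con (+ 0) := con (+ 0)) refl a b))
  sum-bidiagonal a b (suc n) f z zero    = trans (+-congˡ (sumFin-0 {n} (λ i → zeroʳ _)))
    (solve 3 (λ f a b → f :* b :+ con (+ 0) := a :* con (+ 0) :+ b :* f) refl _ _ _)
  sum-bidiagonal a b (suc n) f z (suc zero) = trans (+-congˡ (sum-bidiagonal a b n (f ∘ suc) z zero))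
    (solve 4 (λ f g a b → f :* a :+ (a :* con (+ 0) :+ b :* g) := a :* f :+ b :* g) refl _ _ _ _)
  sum-bidiagonal a b (suc n) f z (suc (suc k)) = trans (+-congˡ (sum-bidiagonal a b n (f ∘ suc) z (suc k)))
    (solve 4 (λ x f a b → x :* con (+ 0) :+ (a :* f :+ b) := a :* f :+ b) refl _ _ _ _)

  -- ∑_{k ≤ n} fₖ aⁿ⁻ᵏ (-b)ᵏ, the homogeneous value at t = -b/a of the polynomial with coefficients f
  evaluate : Carrier → Carrier → ℕ → (ℕ → Carrier) → Carrier
  evaluate a b zero    f = f 0
  evaluate a b (suc n) f = f 0 * power a (suc n) - b * evaluate a b n (f ∘ suc)

  -- The Sylvester matrix of `f` and a t + b; its determinant is a resultant, the division-free
  -- value of `f` at the root.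
  sylvester : Carrier → Carrier → ∀ n → (ℕ → Carrier) → Matrix (suc n)
  sylvester a b n f zero    k = f (toℕ k)
  sylvester a b n f (suc i) k = bidiagonal a b i k

  det-bidiagonal : ∀ a b n → det {n} (λ i k → bidiagonal a b i (suc k)) ≈ power a n
  det-bidiagonal a b zero    = solve 0 (con (+ 1) :* con (+ 1) :+ con (+ 0) := con (+ 1)) refl
  det-bidiagonal a b (suc n) = trans (det-firstRow {n} (λ i k → bidiagonal a b i (suc k)) (λ _ → refl))
    (*-congˡ (det-bidiagonal a b n))

  -- The first column has only the entries `f 0` and `b`. Removing the row of `f 0` leaves a
  -- triangular matrix with diagonal `a`; removing that of `b` leaves the Sylvester matrix of
  -- `f ∘ suc`.
  det-sylvester : ∀ a b n f → det (sylvester a b n f) ≈ evaluate a b n f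
  det-sylvester a b zero    f = solve 1 (λ f → con (+ 1) :* (f :* con (+ 1)) :+ con (+ 0) := f) refl (f 0)
  det-sylvester a b (suc n) f = trans (det-column (sylvester a b (suc n) f)) (begin
    1# * f 0 * det {suc n} (λ i k → bidiagonal a b i (suc k)) +
      (- 1# * b * det (minor (sylvester a b (suc n) f) (suc zero) zero) + sumFin {n} (λ i → tail i))
      ≈⟨ +-cong (*-congˡ (det-bidiagonal a b (suc n)))
           (+-cong (*-congˡ (trans (det-cong {suc n} pointwise) (det-sylvester a b n (f ∘ suc))))
                   (sumFin-0 {n} {tail} (λ i → trans (*-congʳ (zeroʳ _)) (zeroˡ _)))) ⟩
    1# * f 0 * power a (suc n) + (- 1# * b * evaluate a b n (f ∘ suc) + 0#)
      ≈⟨ solve 4 (λ f p b e → con (+ 1) :* f :* p :+ (:- con (+ 1) :* b :* e :+ con (+ 0)) := f :* p :- b :* e) refl _ _ _ _ ⟩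
    f 0 * power a (suc n) - b * evaluate a b n (f ∘ suc) ∎)
    where
    tail : Fin n → Carrier
    tail i = - - signPow (toℕ i) * 0# * det (minor (sylvester a b (suc n) f) (suc (suc i)) zero)
    pointwise : ∀ i k → minor (sylvester a b (suc n) f) (suc zero) zero i k ≈ sylvester a b n (f ∘ suc) i k
    pointwise zero    k = refl
    pointwise (suc i) k = refl

  evaluate-linear : ∀ a b n p q f g →
    evaluate a b n (λ k → p * f k + q * g k) ≈ p * evaluate a b n f + q * evaluate a b n g
  evaluate-linear a b zero    p q f g = refl
  evaluate-linear a b (suc n) p q f g = trans
    (+-congˡ (-‿cong (*-congˡ (evaluate-linear a b n p q (f ∘ suc) (g ∘ suc)))))
    (solve 8 (λ p q f g w b x y → (p :* f :+ q :* g) :* w :- b :* (p :* x :+ q :* y)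
      := p :* (f :* w :- b :* x) :+ q :* (g :* w :- b :* y)) refl _ _ _ _ _ _ _ _)

  -- Raising the formal degree by one multiplies the homogenized value by `a`.
  evaluate-suc : ∀ a b n f → f (suc n) ≈ 0# → evaluate a b (suc n) f ≈ a * evaluate a b n f
  evaluate-suc a b zero    f z = trans (+-congˡ (-‿cong (*-congˡ z)))
    (solve 3 (λ f a b → f :* (a :* con (+ 1)) :- b :* con (+ 0) := a :* f) refl _ _ _)
  evaluate-suc a b (suc n) f z = trans (+-congˡ (-‿cong (*-congˡ (evaluate-suc a b n (f ∘ suc) z))))
    (solve 5 (λ f a p b e → f :* (a :* p) :- b :* (a :* e) := a :* (f :* p :- b :* e)) refl _ _ _ _ _)

  -- Evaluation is multiplicative, and the homogenized value of p t + q at -b/a is a q - p b.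
  evaluate-factor : ∀ a b n p q f → f (suc n) ≈ 0# →
    evaluate a b (suc n) (λ k → p * shift f k + q * f k) ≈ (a * q - p * b) * evaluate a b n f
  evaluate-factor a b n p q f z = begin
    (p * 0# + q * f 0) * power a (suc n) - b * evaluate a b n (λ k → p * f k + q * f (suc k))
      ≈⟨ +-congˡ (-‿cong (*-congˡ (evaluate-linear a b n p q f (f ∘ suc)))) ⟩
    (p * 0# + q * f 0) * power a (suc n) - b * (p * evaluate a b n f + q * evaluate a b n (f ∘ suc))
      ≈⟨ solve 7 (λ p q f w b x y → (p :* con (+ 0) :+ q :* f) :* w :- b :* (p :* x :+ q :* y)
           := q :* (f :* w :- b :* y) :- p :* b :* x) refl _ _ _ _ _ _ _ ⟩
    q * evaluate a b (suc n) f - p * b * evaluate a b n f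
      ≈⟨ +-congʳ (*-congˡ (evaluate-suc a b n f z)) ⟩
    q * (a * evaluate a b n f) - p * b * evaluate a b n f
      ≈⟨ solve 5 (λ a q p b x → q :* (a :* x) :- p :* b :* x := (a :* q :- p :* b) :* x) refl _ _ _ _ _ ⟩
    (a * q - p * b) * evaluate a b n f ∎

  evaluate-coefficient : ∀ a b {n} (v u : Vector n) →
    evaluate a b n (coefficient v u) ≈ prodFin (λ j → a * u j - v j * b)
  evaluate-coefficient a b {zero}  v u = refl
  evaluate-coefficient a b {suc n} v u = trans
    (evaluate-factor a b n (v zero) (u zero) (coefficient (v ∘ suc) (u ∘ suc))
      (coefficient-vanish (v ∘ suc) (u ∘ suc) (suc n) ℕ.≤-refl))
    (*-congˡ (evaluate-coefficient a b (v ∘ suc) (u ∘ suc)))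

  omitMatrix : ∀ {n} → Vector (suc n) → Vector (suc n) → Matrix (suc n)
  omitMatrix v u i k = coefficient-omit v u i (toℕ k)

  -- The polynomials ∏_{j ≠ i} (vⱼ t + uⱼ) with i ≥ 1 are multiples of v₀ t + u₀, so modulo the
  -- matrix of the quotients only the value of the polynomial with i = 0 at the root matters.
  det-omitMatrix : ∀ {n} (v u : Vector (suc n)) → det (omitMatrix v u) ≈ pairProduct v u
  det-omitMatrix {zero}  v u = solve 0 (con (+ 1) :* (con (+ 1) :* con (+ 1)) :+ con (+ 0) := con (+ 1) :* con (+ 1)) refl
  det-omitMatrix {suc n} v u = begin
    det (omitMatrix v u)             ≈⟨ det-cong {suc (suc n)} factor ⟩
    det (λ i → L i ∙ K)              ≈⟨ det-∙ L K ⟩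
    det L * det K                    ≈⟨ *-cong (trans (det-firstRow L (λ _ → refl)) (*-identityˡ _)) (det-sylvester a b (suc n) f) ⟩
    det Q * evaluate a b (suc n) f   ≈⟨ *-cong (det-omitMatrix (v ∘ suc) (u ∘ suc)) (evaluate-coefficient a b (v ∘ suc) (u ∘ suc)) ⟩
    pairProduct (v ∘ suc) (u ∘ suc) * prodFin (λ j → a * u (suc j) - v (suc j) * b)
                                     ≈⟨ *-comm _ _ ⟩
    pairProduct v u                  ∎
    where
    a = v zero
    b = u zero
    f = coefficient (v ∘ suc) (u ∘ suc)
    Q = omitMatrix (v ∘ suc) (u ∘ suc)
    -- Row zero of `K` is the polynomial with i = 0 and its other rows multiply by v₀ t + u₀; the
    -- lower rows of `L` hold the quotients, which form the same matrix for one vector entry less.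
    K = sylvester a b (suc n) f
    L : Matrix (suc (suc n))
    L zero    zero    = 1#
    L zero    (suc l) = 0#
    L (suc i) zero    = 0#
    L (suc i) (suc l) = Q i l
    factor : ∀ i k → omitMatrix v u i k ≈ (L i ∙ K) k
    factor zero    k = sym (trans (+-cong (*-identityˡ _) (sumFin-0 {suc n} {λ i → 0# * bidiagonal a b i k} (λ i → zeroˡ _))) (+-identityʳ _))
    factor (suc i) k = sym (trans (+-cong (zeroˡ _) (sum-bidiagonal a b (suc n) (coefficient-omit (v ∘ suc) (u ∘ suc) i)
      (coefficient-vanish _ _ (suc n) ℕ.≤-refl) k)) (+-identityˡ _))

  -- The column uᵢ E_0(i) would be constantly E_0; it is replaced by ones, and E_0 goes into the
  -- corner of `middle`.
  borderedMatrix : ∀ {n} → Vector (suc n) → Vector (suc n) → Matrix (suc n)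
  borderedMatrix v u i zero    = 1#
  borderedMatrix v u i (suc k) = u i * coefficient-omit v u i (suc (toℕ k))

  -- Subtract row zero from row i. With P the product omitting the factors 0 and i, uᵢ (v₀ t + u₀) P
  -- - u₀ (vᵢ t + uᵢ) P = (v₀ uᵢ - vᵢ u₀) t P, which leaves a diagonal factor times `omitMatrix` of
  -- the tails.
  det-borderedMatrix : ∀ {n} (v u : Vector (suc n)) → det (borderedMatrix v u) ≈ pairProduct v u
  det-borderedMatrix {zero}  v u = solve 0 (con (+ 1) :* (con (+ 1) :* con (+ 1)) :+ con (+ 0) := con (+ 1) :* con (+ 1)) refl
  det-borderedMatrix {suc n} v u = begin
    det X                  ≈⟨ det-cong {suc (suc n)} factor ⟩
    det (λ i → L i ∙ K)    ≈⟨ det-∙ L K ⟩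
    det L * det K          ≈⟨ *-cong (trans (det-firstRow L (λ _ → refl)) (trans (*-identityˡ _) (det-diagonal d)))
                                     (trans (det-firstColumn K (λ _ → refl)) (trans (*-identityˡ _) (det-omitMatrix v′ u′))) ⟩
    pairProduct v u        ∎
    where
    X  = borderedMatrix v u
    v′ = v ∘ suc
    u′ = u ∘ suc
    d : Vector (suc n)
    d i = v zero * u (suc i) - v (suc i) * u zero
    L K : Matrix (suc (suc n))
    L zero    zero    = 1#
    L zero    (suc l) = 0#
    L (suc i) zero    = 1#
    L (suc i) (suc l) = diagonal d i l
    K zero    k       = X zero k
    K (suc l) zero    = 0#
    K (suc l) (suc k) = omitMatrix v′ u′ l k
    factor : ∀ i k → X i k ≈ (L i ∙ K) k
    factor zero    k       = sym (trans (+-cong (*-identityˡ _) (sumFin-0 {suc n} {λ l → 0# * K (suc l) k} (λ l → zeroˡ _))) (+-identityʳ _))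
    factor (suc i) zero    = sym (trans (+-cong (*-identityˡ _) (sumFin-0 {suc n} {λ l → diagonal d i l * 0#} (λ l → zeroʳ _))) (+-identityʳ _))
    factor (suc i) (suc k) = sym (trans
      (+-cong (*-congˡ (*-congˡ (coefficient-split v′ u′ i (suc (toℕ k)))))
              (sum-diagonalˡ d (λ l → omitMatrix v′ u′ l k) i))
      (solve 6 (λ v v₀ u u₀ r s → con (+ 1) :* (u₀ :* (v :* r :+ u :* s)) :+ (v₀ :* u :- v :* u₀) :* r
          := u :* (v₀ :* r :+ u₀ :* s)) refl
        (v (suc i)) (v zero) (u (suc i)) (u zero)
        (coefficient-omit v′ u′ i (toℕ k)) (coefficient-omit v′ u′ i (suc (toℕ k)))))

  -- The factorization of C₁

  fromℕ-^ : ∀ x m → fromℕ (x ^ m) ≈ power (fromℕ x) m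
  fromℕ-^ x zero    = +-identityʳ 1#
  fromℕ-^ x (suc m) = trans (fromℕ-* x (x ^ m)) (*-congˡ (fromℕ-^ x m))

  fromℕ-prodℕ : ∀ m f → fromℕ (prodℕ m f) ≈ prodFin {m} (λ k → fromℕ (f (suc (toℕ k))))
  fromℕ-prodℕ zero    f = +-identityʳ 1#
  fromℕ-prodℕ (suc m) f = trans (fromℕ-* (prodℕ m f) (f (suc m))) (trans
    (*-congʳ (fromℕ-prodℕ m f)) (sym (prodFin-last m (λ k → fromℕ (f (suc k))))))

  fromℕ-coeff : ∀ m → let n = suc (suc m) in
    fromℕ (coeff n) ≈ power (fromℕ n) m * prodFin {suc m} (λ k → fromℕ (diagonalWeight (suc m) (toℕ k)))
  fromℕ-coeff m = trans (fromℕ-cong (coeff-explicit m)) (trans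
    (fromℕ-* (suc (suc m) ^ m) _)
    (*-cong (fromℕ-^ (suc (suc m)) m) (fromℕ-prodℕ (suc m) _)))

  module Middle {m} (v u w z : Vector (suc m)) where
    E F : ℕ → Carrier
    E = coefficient v u
    F = coefficient w z

    N : ℕ → Carrier
    N = weight m

    -- Put x = uᵢ E_{k+1}(i) and y = zⱼ F_{k+1}(j). In N_k (E_{k+1} - x) (F_{k+1} - y) + N_{k+1} x y
    -- the constant part goes to `corner`, the coefficients of y and x are `row` and `column`, and
    -- that of x y is `diag`.
    corner : Carrier
    corner = N 0 * (E 0 * F 0) + sumFin {suc m} (λ k → N (toℕ k) * (E (suc (toℕ k)) * F (suc (toℕ k))))

    row column diag : Vector m
    row    k = - (N (toℕ k) * E (suc (toℕ k)))
    column k = - (N (toℕ k) * F (suc (toℕ k)))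
    diag   k = fromℕ (suc m) * fromℕ (diagonalWeight m (toℕ k))

    middle : Matrix (suc m)
    middle = arrow corner row column diag

    diag-split : ∀ k → diag k ≈ N (toℕ k) + N (suc (toℕ k))
    diag-split k = trans (sym (fromℕ-* (suc m) (diagonalWeight m (toℕ k)))) (trans
      (fromℕ-cong (factorialWeight-+ (Fin.toℕ<n k))) (fromℕ-+ (factorialWeight m (toℕ k)) _))

    product-entry : ∀ (X Y : Matrix (suc m)) i j → X i zero ≈ 1# → Y j zero ≈ 1# →
      ((X i ∙ middle) ∙ (λ l j → Y j l)) j ≈
      corner + sumFin (λ k → X i (suc k) * column k + (row k + X i (suc k) * diag k) * Y j (suc k))
    product-entry X Y i j x y = begin
      (X i zero * corner + S₁) * Y j zero +
        sumFin (λ l → (X i zero * row l + sumFin (λ k → X i (suc k) * diagonal diag k l)) * Y j (suc l))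
        ≈⟨ +-cong (*-cong (+-congʳ (*-congʳ x)) y)
             (sumFin-cong {m} (λ l → *-congʳ (+-cong (trans (*-congʳ x) (*-identityˡ _)) (sum-diagonalʳ diag (λ k → X i (suc k)) l)))) ⟩
      (1# * corner + S₁) * 1# + S₂
        ≈⟨ solve 3 (λ s x y → (con (+ 1) :* s :+ x) :* con (+ 1) :+ y := s :+ (x :+ y)) refl corner S₁ S₂ ⟩
      corner + (S₁ + S₂)
        ≈⟨ +-congˡ (sym (sumFin-+ {m} _ _)) ⟩
      corner + sumFin (λ k → X i (suc k) * column k + (row k + X i (suc k) * diag k) * Y j (suc k)) ∎
      where
      S₁ = sumFin (λ k → X i (suc k) * column k)
      S₂ = sumFin (λ k → (row k + X i (suc k) * diag k) * Y j (suc k))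

    C₁-entry : ∀ i j → C₁ (rankTwo v u w z) i j ≈
      corner + sumFin (λ k → borderedMatrix v u i (suc k) * column k +
        (row k + borderedMatrix v u i (suc k) * diag k) * borderedMatrix w z j (suc k))
    C₁-entry i j = begin
      (a * a′ + b * b′) * per (rankTwo (v ∘ punchIn i) (u ∘ punchIn i) (w ∘ punchIn j) (z ∘ punchIn j))
        ≈⟨ *-congˡ (per-rankTwo (v ∘ punchIn i) (u ∘ punchIn i) (w ∘ punchIn j) (z ∘ punchIn j)) ⟩
      (a * a′ + b * b′) * sumFin {suc m} (λ k → N (toℕ k) * (x (toℕ k) * y (toℕ k)))
        ≈⟨ sumFin-*ˡ {suc m} (a * a′ + b * b′) (λ k → N (toℕ k) * (x (toℕ k) * y (toℕ k))) ⟨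
      sumFin {suc m} (λ k → (a * a′ + b * b′) * (N (toℕ k) * (x (toℕ k) * y (toℕ k))))
        ≈⟨ sumFin-cong {suc m} (λ k → solve 7 (λ a a′ b b′ n x y → (a :* a′ :+ b :* b′) :* (n :* (x :* y))
             := n :* (a :* x :* (a′ :* y)) :+ n :* (b :* x :* (b′ :* y))) refl a a′ b b′ (N (toℕ k)) (x (toℕ k)) (y (toℕ k))) ⟩
      sumFin {suc m} (λ k → fst (toℕ k) + snd (toℕ k))
        ≈⟨ sumFin-+ {suc m} (fst ∘ toℕ) (snd ∘ toℕ) ⟩
      sumFin {suc m} (fst ∘ toℕ) + sumFin {suc m} (snd ∘ toℕ)
        -- The v-term at k is to be paired with the u-term at k + 1, as both involve E_{k+1}(i). The
        -- unpaired ends, the v-term at `m` and the u-term at 0, do not depend on `i` and `j`.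
        ≈⟨ +-congʳ (sumFin-last m fst) ⟩
      (sumFin {m} (fst ∘ toℕ) + fst m) + (snd 0 + sumFin {m} (snd ∘ suc ∘ toℕ))
        ≈⟨ +-cong (+-congˡ (*-congˡ (*-cong (last v u i) (last w z j)))) (+-congʳ (*-congˡ (*-cong (first v u i) (first w z j)))) ⟩
      (sumFin {m} (fst ∘ toℕ) + G m) + (N 0 * (E 0 * F 0) + sumFin {m} (snd ∘ suc ∘ toℕ))
        ≈⟨ solve 4 (λ p g e q → (p :+ g) :+ (e :+ q) := (e :+ g) :+ (p :+ q)) refl _ _ _ _ ⟩
      (N 0 * (E 0 * F 0) + G m) + (sumFin {m} (fst ∘ toℕ) + sumFin {m} (snd ∘ suc ∘ toℕ))
        ≈⟨ +-congˡ (trans (sym (sumFin-+ {m} (fst ∘ toℕ) (snd ∘ suc ∘ toℕ))) (sumFin-cong {m} term)) ⟩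
      (N 0 * (E 0 * F 0) + G m) + sumFin (λ k → G (toℕ k) + inner k)
        ≈⟨ +-congˡ (sumFin-+ {m} (G ∘ toℕ) inner) ⟩
      (N 0 * (E 0 * F 0) + G m) + (sumFin {m} (G ∘ toℕ) + sumFin inner)
        ≈⟨ solve 4 (λ e g p q → (e :+ g) :+ (p :+ q) := (e :+ (p :+ g)) :+ q) refl _ _ _ _ ⟩
      (N 0 * (E 0 * F 0) + (sumFin {m} (G ∘ toℕ) + G m)) + sumFin inner
        ≈⟨ +-congʳ (+-congˡ (sumFin-last m G)) ⟨
      corner + sumFin inner ∎
      where
      a = v i
      b = u i
      a′ = w j
      b′ = z j
      x = coefficient-omit v u i
      y = coefficient-omit w z j
      fst snd G : ℕ → Carrier
      fst k = N k * (a * x k * (a′ * y k))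
      snd k = N k * (b * x k * (b′ * y k))
      G   k = N k * (E (suc k) * F (suc k))
      inner : Vector m
      inner k = borderedMatrix v u i (suc k) * column k +
        (row k + borderedMatrix v u i (suc k) * diag k) * borderedMatrix w z j (suc k)
      first : ∀ (v u : Vector (suc m)) i → u i * coefficient-omit v u i 0 ≈ coefficient v u 0
      first v u i = sym (trans (coefficient-split v u i 0) (trans (+-congʳ (zeroʳ _)) (+-identityˡ _)))
      last : ∀ (v u : Vector (suc m)) i → v i * coefficient-omit v u i m ≈ coefficient v u (suc m)
      last v u i = sym (trans (coefficient-split v u i (suc m)) (trans
        (+-congˡ (trans (*-congˡ (coefficient-vanish (v ∘ punchIn i) (u ∘ punchIn i) (suc m) ℕ.≤-refl)) (zeroʳ _))) (+-identityʳ _)))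
      remaining : ∀ (v u : Vector (suc m)) i k →
        v i * coefficient-omit v u i k ≈ coefficient v u (suc k) - u i * coefficient-omit v u i (suc k)
      remaining v u i k = trans (solve 2 (λ p q → p := (p :+ q) :- q) refl _ _) (+-congʳ (sym (coefficient-split v u i (suc k))))
      term : ∀ k → fst (toℕ k) + snd (suc (toℕ k)) ≈ G (toℕ k) + inner k
      term k = trans
        (+-congʳ (*-congˡ (*-cong (remaining v u i (toℕ k)) (remaining w z j (toℕ k)))))
        (trans
          (solve 6 (λ n n′ e f x y → n :* ((e :- x) :* (f :- y)) :+ n′ :* (x :* y)
             := n :* (e :* f) :+ (x :* :- (n :* f) :+ (:- (n :* e) :+ x :* (n :+ n′)) :* y)) refl
             (N (toℕ k)) (N (suc (toℕ k))) (E (suc (toℕ k))) (F (suc (toℕ k)))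
             (b * x (suc (toℕ k))) (b′ * y (suc (toℕ k))))
          (+-congˡ (+-congˡ (*-congʳ (+-congˡ (*-congˡ (sym (diag-split k))))))))

    det-C₁ : det (C₁ (rankTwo v u w z)) ≈ pairProduct v u * det middle * pairProduct w z
    det-C₁ = begin
      det (C₁ (rankTwo v u w z))
        ≈⟨ det-cong {suc m} (λ i j → trans (C₁-entry i j) (sym (product-entry X Y i j refl refl))) ⟩
      det (λ i → (X i ∙ middle) ∙ (λ l j → Y j l))
        ≈⟨ det-∙ (λ i → X i ∙ middle) (λ l j → Y j l) ⟩
      det (λ i → X i ∙ middle) * det (λ l j → Y j l)
        ≈⟨ *-cong (det-∙ X middle) (det-transpose Y) ⟩
      det X * det middle * det Y
        ≈⟨ *-cong (*-congʳ (det-borderedMatrix v u)) (det-borderedMatrix w z) ⟩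
      pairProduct v u * det middle * pairProduct w z ∎
      where
      X = borderedMatrix v u
      Y = borderedMatrix w z

    -- The surplus of n times the corner over the permanent; the products of row and column entries
    -- of `middle` give the same terms, so they cancel.
    excess : ℕ → Carrier
    excess k = fromℕ (m ∸ k) * (N k * (E (suc k) * F (suc k)))

    -- Split n as (k+1) + (m-k): the first part turns N_k into the weight of E_{k+1} F_{k+1} in the
    -- permanent, the second is `excess`, which is zero at k = m.
    n*corner : fromℕ (suc m) * corner ≈ per (rankTwo v u w z) + sumFin {m} (excess ∘ toℕ)
    n*corner = begin
      fromℕ (suc m) * corner
        ≈⟨ trans (distribˡ _ _ _) (+-cong (sym (*-assoc _ _ _)) (sym (sumFin-*ˡ {suc m} _ (G ∘ toℕ)))) ⟩
      fromℕ (suc m) * N 0 * (E 0 * F 0) + sumFin {suc m} (λ k → fromℕ (suc m) * G (toℕ k))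
        ≈⟨ +-cong (*-congʳ (trans (sym (fromℕ-* (suc m) (factorialWeight m 0))) (fromℕ-cong (≡.sym (factorialWeight-sucˡ {m} z≤n)))))
             (sumFin-cong {suc m} (λ k → term (toℕ k) (Fin.toℕ≤pred[n] k))) ⟩
      H 0 + sumFin {suc m} (λ k → H (suc (toℕ k)) + excess (toℕ k))
        ≈⟨ +-congˡ (sumFin-+ {suc m} (H ∘ suc ∘ toℕ) (excess ∘ toℕ)) ⟩
      H 0 + (sumFin {suc m} (H ∘ suc ∘ toℕ) + sumFin {suc m} (excess ∘ toℕ))
        ≈⟨ sym (+-assoc _ _ _) ⟩
      sumFin {suc (suc m)} (H ∘ toℕ) + sumFin {suc m} (excess ∘ toℕ)
        ≈⟨ +-cong (sym (per-rankTwo v u w z)) (trans (sumFin-last m excess) (trans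
             (+-congˡ (trans (*-congʳ (fromℕ-cong (ℕ.n∸n≡0 m))) (zeroˡ _))) (+-identityʳ _))) ⟩
      per (rankTwo v u w z) + sumFin {m} (excess ∘ toℕ) ∎
      where
      G H : ℕ → Carrier
      G k = N k * (E (suc k) * F (suc k))
      H k = weight (suc m) k * (E k * F k)
      term : ∀ k → k ≤ m → fromℕ (suc m) * G k ≈ H (suc k) + excess k
      term k k≤m = begin
        fromℕ (suc m) * G k
          ≈⟨ *-congʳ (trans (fromℕ-cong (≡.cong suc (≡.sym (ℕ.m+[n∸m]≡n k≤m)))) (fromℕ-+ (suc k) (m ∸ k))) ⟩
        (fromℕ (suc k) + fromℕ (m ∸ k)) * G k
          ≈⟨ solve 4 (λ p q n g → (p :+ q) :* (n :* g) := p :* n :* g :+ q :* (n :* g)) refl _ _ _ _ ⟩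
        fromℕ (suc k) * N k * (E (suc k) * F (suc k)) + excess k
          ≈⟨ +-congʳ (*-congʳ (trans (sym (fromℕ-* (suc k) (factorialWeight m k))) (fromℕ-cong (≡.sym (factorialWeight-suc m k))))) ⟩
        H (suc k) + excess k ∎

  det-middle : ∀ {m} (v u w z : Vector (suc (suc m))) →
    det (Middle.middle v u w z) ≈ fromℕ (coeff (suc (suc m))) * per (rankTwo v u w z)
  det-middle {m} v u w z = begin
    det middle
      ≈⟨ det-arrow corner row column diag ⟩
    corner * prodFin diag - derivation diag (λ k → row k * column k)
      ≈⟨ +-cong (*-congˡ (prodFin-* {suc m} (λ _ → n) g))
           (-‿cong (trans (derivation-cong {d = diag} (λ _ → refl) rowColumn) (derivation-scaled n g (excess ∘ toℕ)))) ⟩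
    corner * (n * power n m * prodFin g) - power n m * prodFin g * S
      ≈⟨ solve 5 (λ s n p g t → s :* (n :* p :* g) :- p :* g :* t := p :* g :* (n :* s :- t)) refl corner n (power n m) (prodFin g) S ⟩
    power n m * prodFin g * (n * corner - S)
      ≈⟨ *-cong (sym (fromℕ-coeff m)) (+-congʳ n*corner) ⟩
    fromℕ (coeff (suc (suc m))) * (per (rankTwo v u w z) + S - S)
      ≈⟨ *-congˡ (solve 2 (λ p s → p :+ s :- s := p) refl _ S) ⟩
    fromℕ (coeff (suc (suc m))) * per (rankTwo v u w z) ∎
    where
    open Middle v u w z
    n = fromℕ (suc (suc m))
    g : Vector (suc m)
    g k = fromℕ (diagonalWeight (suc m) (toℕ k))
    S = sumFin {suc m} (excess ∘ toℕ)
    rowColumn : ∀ k → row k * column k ≈ g k * excess (toℕ k)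
    rowColumn k = trans
      (solve 3 (λ n e f → :- (n :* e) :* :- (n :* f) := n :* (n :* (e :* f))) refl _ _ _)
      (trans (*-congʳ (trans (fromℕ-cong (factorialWeight-diagonalWeight (Fin.toℕ<n k))) (fromℕ-* (suc m ∸ toℕ k) (diagonalWeight (suc m) (toℕ k)))))
        (solve 3 (λ x g y → x :* g :* y := g :* (x :* y)) refl _ _ _))

  -- Conjugation and the squared absolute values

  module _ {conj : Carrier → Carrier} (isInvolution : IsInvolution conj) where
    open IsInvolution isInvolution
    open GroupProperties +-group using (identityˡ-unique; inverseˡ-unique)

    conj-0 : conj 0# ≈ 0#
    conj-0 = identityˡ-unique _ _ (trans (sym (conj-+ 0# 0#)) (cong-conj (+-identityˡ 0#)))

    conj-neg : ∀ x → conj (- x) ≈ - conj x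
    conj-neg x = inverseˡ-unique _ _ (trans (sym (conj-+ (- x) x)) (trans (cong-conj (-‿inverseˡ x)) conj-0))

    conj-minor : ∀ a b d e → conj (a * b - d * e) ≈ conj a * conj b - conj d * conj e
    conj-minor a b d e = trans (conj-+ _ _) (+-cong (conj-* a b) (trans (conj-neg _) (-‿cong (conj-* d e))))

    vandermondeLike-pairProduct : ∀ {n} (v u : Vector n) →
      vandermondeLike conj v u ≈ pairProduct v u * pairProduct (conj ∘ v) (conj ∘ u)
    vandermondeLike-pairProduct {zero}  v u = sym (*-identityˡ 1#)
    vandermondeLike-pairProduct {suc n} v u = begin
      -- Each `1#` belongs to column zero, where the comparison of indices fails; comparing
      -- successors reduces to comparing the tails' indices.
      1# * prodFin (λ j → absSq conj (minor₂ j)) * prodFin (λ i → 1# * prodFin (λ j → entry i j))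
        ≈⟨ *-cong (trans (*-identityˡ _) (trans
             (prodFin-cong {n} (λ j → *-congˡ (conj-minor _ _ _ _)))
             (prodFin-* {n} minor₂ _)))
           (trans (prodFin-cong {n} (λ i → *-identityˡ _)) (vandermondeLike-pairProduct (v ∘ suc) (u ∘ suc))) ⟩
      (p * q) * (pairProduct (v ∘ suc) (u ∘ suc) * pairProduct (conj ∘ v ∘ suc) (conj ∘ u ∘ suc))
        ≈⟨ solve 4 (λ a b x y → (a :* b) :* (x :* y) := (a :* x) :* (b :* y)) refl _ _ _ _ ⟩
      pairProduct v u * pairProduct (conj ∘ v) (conj ∘ u) ∎
      where
      minor₂ : Fin n → Carrier
      minor₂ j = v zero * u (suc j) - v (suc j) * u zero
      p = prodFin minor₂
      q = prodFin (λ j → conj (v zero) * conj (u (suc j)) - conj (v (suc j)) * conj (u zero))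
      entry : Fin n → Fin n → Carrier
      entry i j = if toℕ i <ᵇ toℕ j then absSq conj (v (suc i) * u (suc j) - v (suc j) * u (suc i)) else 1#

theorem3p1 : ∀ {c ℓ} (R : CommutativeRing c ℓ) →
    let open CommutativeRing R hiding (zero)
        open OverRing R
    in (conj : Carrier → Carrier) → IsInvolution conj →
       (n : ℕ) → 2 ≤ n → (v u : Vector n) →
       det (C₁ (rank2H conj v u))
         ≈ fromℕ (coeff n) * per (rank2H conj v u) * vandermondeLike conj v u
theorem3p1 R conj isInvolution (suc (suc m)) (s≤s (s≤s z≤n)) v u = begin
  det (C₁ (rank2H conj v u))
    -- `rank2H conj v u` unfolds to `rankTwo` with w and z the conjugates of v and u.
    ≈⟨ Middle.det-C₁ v u (conj ∘ v) (conj ∘ u) ⟩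
  pairProduct v u * det (Middle.middle v u (conj ∘ v) (conj ∘ u)) * pairProduct (conj ∘ v) (conj ∘ u)
    ≈⟨ *-congʳ (*-congˡ (det-middle v u (conj ∘ v) (conj ∘ u))) ⟩
  pairProduct v u * (fromℕ (coeff (suc (suc m))) * per (rank2H conj v u)) * pairProduct (conj ∘ v) (conj ∘ u)
    ≈⟨ solve 3 (λ p k q → p :* k :* q := k :* (p :* q)) refl _ _ _ ⟩
  fromℕ (coeff (suc (suc m))) * per (rank2H conj v u) * (pairProduct v u * pairProduct (conj ∘ v) (conj ∘ u))
    ≈⟨ *-congˡ (vandermondeLike-pairProduct isInvolution v u) ⟨
  fromℕ (coeff (suc (suc m))) * per (rank2H conj v u) * vandermondeLike conj v u ∎
  where
  open CommutativeRing R hiding (zero)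
  open OverRing R
  open CommutativeRingTheory R
  open IntegerCoefficientSolver using (solve; _:=_; _:*_)
  open import Relation.Binary.Reasoning.Setoid setoid
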